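{- Let $\Gamma$ be a constraint language such that $\mathrm{SAT}(\Gamma^+)$ is solvable in time $f(n)$ for some computable function $f\colon\mathbb{N}\to\mathbb{N}$, where $n$ is the number of variables. Then, up to polynomial overhead, (1) $\mathrm{ABD}(\Gamma)$ is solvable in time $2^{|H|}\cdot f(n-|H|)\cdot(|M|+1)$, and (2) $\mathrm{P\text{ - }ABD}(\Gamma)$ is solvable in time $\sum_{E\subseteq H} f(n-|E|)\cdot(|M|+1)$.
   Context: A logical relation of arity $k$ is a set $R\subseteq\{0,1\}^k$. A (Boolean) constraint language $\Gamma$ is a set of logical relations; a $\Gamma$-formula is a conjunction of constraints $R(x_1,\dots,x_k)$ with $R\in\Gamma$ and $x_1,\dots,x_k$ not necessarily distinct variables; it is satisfied by an assignment $\sigma$ if $(\sigma(x_1),\dots,\sigma(x_k))\in R$ for every constraint. $\mathrm{SAT}(\Gamma)$ asks whether a given $\Gamma$-formula has a model. $\Gamma^+=\Gamma\cup\{\bot,\top\}$ where $\bot=\{(0)\}$, $\top=\{(1)\}$. An instance of $\mathrm{ABD}(\Gamma)$ is a triple $(\mathrm{KB},H,M)$ with $\mathrm{KB}$ a $\Gamma$-formula and $H$ (hypotheses), $M$ (manifestations) sets of variables; $n=|\mathrm{var}(\mathrm{KB})\cup H\cup M|$. $\mathrm{ABD}(\Gamma)$ asks whether there is a set of literals $E\subseteq H\cup\{\neg x: x\in H\}$ such that $\mathrm{KB}\wedge E$ is satisfiable and $\mathrm{KB}\wedge E\models m$ for every $m\in M$ (such $E$ is an explanation). $\mathrm{P\text{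 - }ABD}(\Gamma)$ asks the same but requires $E\subseteq H$ (a positive explanation). -}

module Defs where

open import Data.Bool using (Bool; true; false; not)
import Data.Bool.Properties as Bool
open import Data.List using (List; []; _∷_; _++_; map; length; concatMap; deduplicate)
open import Data.List.Membership.Propositional using (_∈_)
import Data.List.Properties as List
open import Data.List.Relation.Binary.Subset.Propositional using (_⊆_)
open import Data.List.Relation.Unary.All using (All)
open import Data.List.Relation.Unary.Unique.Propositional using (Unique)
open import Data.Nat using (ℕ; zero; suc; _+_; _*_; _^_; _≤_)
open import Data.Product using (_×_; ∃-syntax)
open import Data.Vec as Vec using (Vec)
open import Function.Bundles using (_⇔_)
open import Level using (0ℓ)
open import Relation.Binary.Definitions using (DecidableEquality)
open import Relation.Binary.PropositionalEquality using (_≡_)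
open import Relation.Unary using (Pred; _∪_; ｛_｝)

-- A structured WHILE language whose data are binary trees, in the style of
-- N. D. Jones, "Computability and Complexity from a Programming
-- Perspective" (WHILE and its one-variable restriction I).  A program maps
-- the current tree to a tree; every rule charges one unit for itself in
-- addition to the cost of its premises.  With trees stored as shared
-- pointers each unit is a constant amount of work, so running times agree
-- with Turing machine times up to a polynomial.

data Tree : Set where
  leaf : Tree
  node : Tree → Tree → Tree

size : Tree → ℕ
size leaf       = 1
size (node s t) = 1 + size s + size t

infixr 5 _⨾_

data Program : Set where
  id nil hd tl     : Program
  cons             : Program → Program → Program
  _⨾_              : Program → Program → Program
  if_then_else_    : Program → Program → Program → Program
  while_loop_      : Program → Program → Program

infix 4 _∶_⇓_[_]

-- p ∶ x ⇓ y [ t ]  :  p started on x halts with y after exactly t steps.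
-- A test counts as true when its value is not leaf.

data _∶_⇓_[_] : Program → Tree → Tree → ℕ → Set where
  id⇓ : ∀ {x} → id ∶ x ⇓ x [ 1 ]

  nil⇓ : ∀ {x} → nil ∶ x ⇓ leaf [ 1 ]

  hd-leaf⇓ : hd ∶ leaf ⇓ leaf [ 1 ]

  hd-node⇓ : ∀ {x y} → hd ∶ node x y ⇓ x [ 1 ]

  tl-leaf⇓ : tl ∶ leaf ⇓ leaf [ 1 ]

  tl-node⇓ : ∀ {x y} → tl ∶ node x y ⇓ y [ 1 ]

  cons⇓ : ∀ {p q x y z s t} →
          p ∶ x ⇓ y [ s ] → q ∶ x ⇓ z [ t ] →
          cons p q ∶ x ⇓ node y z [ 1 + s + t ]

  ⨾⇓ : ∀ {p q x y z s t} →
       p ∶ x ⇓ y [ s ] → q ∶ y ⇓ z [ t ] →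
       (p ⨾ q) ∶ x ⇓ z [ 1 + s + t ]

  if-true⇓ : ∀ {p q r x u v y s t} →
             p ∶ x ⇓ node u v [ s ] → q ∶ x ⇓ y [ t ] →
             (if p then q else r) ∶ x ⇓ y [ 1 + s + t ]

  if-false⇓ : ∀ {p q r x y s t} →
              p ∶ x ⇓ leaf [ s ] → r ∶ x ⇓ y [ t ] →
              (if p then q else r) ∶ x ⇓ y [ 1 + s + t ]

  while-stop⇓ : ∀ {p q x s} →
                p ∶ x ⇓ leaf [ s ] →
                (while p loop q) ∶ x ⇓ x [ 1 + s ]

  while-step⇓ : ∀ {p q x u v y z s t w} →
                p ∶ x ⇓ node u v [ s ] → q ∶ x ⇓ y [ t ] →
                (while p loop q) ∶ y ⇓ z [ w ] →
                (while p loop q) ∶ x ⇓ z [ 1 + s + t + w ]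

encodeBool : Bool → Tree
encodeBool false = leaf
encodeBool true  = node leaf leaf

encodeℕ : ℕ → Tree
encodeℕ zero    = leaf
encodeℕ (suc n) = node leaf (encodeℕ n)

encodeList : {A : Set} → (A → Tree) → List A → Tree
encodeList enc []       = leaf
encodeList enc (x ∷ xs) = node (enc x) (encodeList enc xs)

Computable : (ℕ → ℕ) → Set
Computable f =
  ∃[ p ] (∀ n → ∃[ t ] p ∶ encodeℕ n ⇓ encodeℕ (f n) [ t ])

record Problem : Set₁ where
  field
    Instance : Set
    encode   : Instance → Tree
    Yes      : Instance → Set

-- Solvable in time T up to polynomial overhead: the running time on x is at
-- most q(size of x) · T x for a fixed polynomial q, taken to be c · sizeᵏ.

SolvableInTime : (P : Problem) → (Problem.Instance P → ℕ) → Set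
SolvableInTime P T =
  ∃[ p ] ∃[ c ] ∃[ k ] ((x : Instance) →
    ∃[ b ] ∃[ t ] (p ∶ encode x ⇓ encodeBool b [ t ]
                  × t ≤ c * size (encode x) ^ k * T x
                  × (b ≡ true ⇔ Yes x)))
  where open Problem P

record LogicalRelation : Set where
  constructor relation
  field
    arity : ℕ
    holds : Vec Bool arity → Bool

open LogicalRelation public

ConstraintLanguage : Set₁
ConstraintLanguage = Pred LogicalRelation 0ℓ

⊥ᴿ ⊤ᴿ : LogicalRelation
⊥ᴿ = relation 1 (λ v → not (Vec.head v))
⊤ᴿ = relation 1 Vec.head

infix 10 _⁺

_⁺ : ConstraintLanguage → ConstraintLanguage
Γ ⁺ = Γ ∪ ｛ ⊥ᴿ ｝ ∪ ｛ ⊤ᴿ ｝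

Var : Set
Var = List Bool

_≟ⱽ_ : DecidableEquality Var
_≟ⱽ_ = List.≡-dec Bool._≟_

card : List Var → ℕ
card xs = length (deduplicate _≟ⱽ_ xs)

Assignment : Set
Assignment = Var → Bool

record Constraint (Γ : ConstraintLanguage) : Set where
  field
    rel   : LogicalRelation
    rel∈Γ : Γ rel
    args  : Vec Var (arity rel)

Formula : ConstraintLanguage → Set
Formula Γ = List (Constraint Γ)

module _ {Γ : ConstraintLanguage} where

  vars : Formula Γ → List Var
  vars = concatMap (λ C → Vec.toList (Constraint.args C))

  SatisfiesConstraint : Assignment → Constraint Γ → Set
  SatisfiesConstraint σ C = holds rel (Vec.map σ args) ≡ true
    where open Constraint C

  infix 4 _⊨_

  _⊨_ : Assignment → Formula Γ → Set
  σ ⊨ φ = All (SatisfiesConstraint σ) φ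

-- How a relation is written down in an input is left open: rep R is the
-- description of R (truth table, list of tuples, clause, name, ...).

Representation : Set
Representation = LogicalRelation → Tree

encodeVar : Var → Tree
encodeVar = encodeList encodeBool

module _ (rep : Representation) {Γ : ConstraintLanguage} where

  encodeConstraint : Constraint Γ → Tree
  encodeConstraint C = node (rep rel) (encodeList encodeVar (Vec.toList args))
    where open Constraint C

  encodeFormula : Formula Γ → Tree
  encodeFormula = encodeList encodeConstraint

SAT : Representation → ConstraintLanguage → Problem
SAT rep Γ = record
  { Instance = Formula Γ
  ; encode   = encodeFormula rep
  ; Yes      = λ φ → ∃[ σ ] (σ ⊨ φ)
  }

data Literal : Set where
  pos neg : Var → Literal

infix 4 _⊨ˡ_

_⊨ˡ_ : Assignment → Literal → Set
σ ⊨ˡ pos x = σ x ≡ true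
σ ⊨ˡ neg x = σ x ≡ false

-- The finite sets H and M are duplicate-free lists.

record AbductionInstance (Γ : ConstraintLanguage) : Set where
  field
    KB       : Formula Γ
    H M      : List Var
    H-unique : Unique H
    M-unique : Unique M

  ∣H∣ ∣M∣ n : ℕ
  ∣H∣ = length H
  ∣M∣ = length M
  n   = card (vars KB ++ H ++ M)

module _ {Γ : ConstraintLanguage} (I : AbductionInstance Γ) where
  open AbductionInstance I

  Explains : List Literal → Set
  Explains E =
      (∃[ σ ] (σ ⊨ KB × All (σ ⊨ˡ_) E))
    × (∀ {m} → m ∈ M → ∀ σ → σ ⊨ KB → All (σ ⊨ˡ_) E → σ ⊨ˡ pos m)

  HasExplanation : Set
  HasExplanation = ∃[ E ] (E ⊆ map pos H ++ map neg H × Explains E)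

  HasPositiveExplanation : Set
  HasPositiveExplanation = ∃[ E ] (E ⊆ map pos H × Explains E)

encodeAbduction : Representation → {Γ : ConstraintLanguage} →
                  AbductionInstance Γ → Tree
encodeAbduction rep I =
  node (encodeFormula rep KB)
       (node (encodeList encodeVar H) (encodeList encodeVar M))
  where open AbductionInstance I

ABD : Representation → ConstraintLanguage → Problem
ABD rep Γ = record
  { Instance = AbductionInstance Γ
  ; encode   = encodeAbduction rep
  ; Yes      = HasExplanation
  }

P-ABD : Representation → ConstraintLanguage → Problem
P-ABD rep Γ = record
  { Instance = AbductionInstance Γ
  ; encode   = encodeAbduction rep
  ; Yes      = HasPositiveExplanation
  }

-- For a duplicate-free list, every subset is listed exactly once.

subsets : {A : Set} → List A → List (List A)
subsets []       = [] ∷ []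
subsets (x ∷ xs) = subsets xs ++ map (x ∷_) (subsets xs)

{-# OPTIONS --safe #-}
module Submission where

open import Defs
open import Data.Bool using (Bool; true; false; not; _∨_) renaming (if_then_else_ to ifᵇ_then_else_)
import Data.Bool.Properties as Bool
open import Data.Empty using (⊥-elim)
open import Data.List using (List; []; _∷_; _++_; map; concatMap; filter; length; deduplicate)
open import Data.List.Membership.DecPropositional _≟ⱽ_ using (_∈_; _∉_; _∈?_; _∉?_)
open import Data.List.Membership.Propositional using (find) renaming (_∈_ to _∈ᵖ_)
open import Data.List.Membership.Propositional.Properties
import Data.List.Properties as List
open import Data.List.Relation.Binary.Subset.Propositional using (_⊆_)
open import Data.List.Relation.Unary.All as All using (All; []; _∷_)
import Data.List.Relation.Unary.All.Properties as All
open import Data.List.Relation.Unary.AllPairs using ([]; _∷_)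
open import Data.List.Relation.Unary.Any as Any using (Any; any?; here; there)
import Data.List.Relation.Unary.Any.Properties as Any
open import Data.List.Relation.Unary.Unique.DecPropositional.Properties _≟ⱽ_ using (deduplicate-!)
open import Data.List.Relation.Unary.Unique.Propositional using (Unique)
import Data.List.Relation.Unary.Unique.Propositional.Properties as Unique
open import Data.Nat
open import Data.Nat.ListAction using (sum)
open import Data.Nat.ListAction.Properties using (sum-++)
open import Data.Nat.Properties
open import Data.Nat.Tactic.RingSolver using (solve-∀)
open import Data.Product using (_×_; _,_; ∃-syntax; proj₁; proj₂)
open import Data.Sum using (_⊎_; inj₁; inj₂; [_,_]′)
open import Data.Vec as Vec using (Vec; []; _∷_)
import Data.Vec.Properties as Vec
open import Function using (_∘_)
open import Function.Bundles using (_⇔_; mk⇔; Equivalence)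
open import Level using (0ℓ)
open import Relation.Binary.PropositionalEquality
open import Relation.Nullary using (Dec; yes; no; ¬_; does; ¬?)
open import Relation.Nullary.Decidable using (dec-true; dec-false)
open import Relation.Unary using (Pred; Decidable)

open Equivalence using (to; from)

-- Search depth-first through the partial assignments α of the hypotheses (all
-- total ones for ABD, the positive ones for P-ABD) and test each by |M| + 1
-- satisfiability queries: KB ∧ α, and KB ∧ α ∧ ¬m for every m ∈ M.
--
-- A query must be answered within f(n - |α|), where f need not be monotone, so
-- it has to be turned into formulas with exactly n - |α| variables although
-- the constants that replace the variables of α occupy two variables
-- themselves.  Two free variables x, y are therefore sacrificed: branch over
-- their four valuations, replace x, y and the variables of α by constants, and
-- reuse the names x and y for the constants false and true.  If fewer than two
-- variables are free, at most three occur altogether and the query costs O(1)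
-- up to the polynomial factor, which is affordable because f is positive.

-- Polynomial bounds

-- The number of candidates is exponential, so every cost besides the weights
-- `f (n ∸ length α) * (∣M∣ + 1)` must be absorbed by one polynomial in the size of the instance,
-- uniformly in the candidate. Two devices achieve this. Every undecided hypothesis reserves a fixed
-- multiple of its own size for its later binding, so no partial assignment outgrows a multiple of
-- the encoding of `H`. And since weights are at least one, the leaves of the search tree pay for
-- its inner nodes and for all constant costs.
--
-- The exact variable count can fail in both directions: besides the surplus from the constants,
-- hypotheses and manifestations need not occur in `KB`, so a query may also have too few variables.
-- Falsifying some `m` in `M` never adds to the count, because `m` is already counted in `n`.

infix 4 _≼_

-- The successor keeps the base nonzero, so powers are monotone in the exponent and two bounds can
-- be brought to the common exponent `k + l`.
_≼_ : {A : Set} → (A → ℕ) → (A → ℕ) → Set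
T ≼ S = ∃[ c ] ∃[ k ] (∀ a → T a ≤ c * suc (S a) ^ k)

module _ {A : Set} where

  ≼-mono : {T U S : A → ℕ} → (∀ a → T a ≤ U a) → U ≼ S → T ≼ S
  ≼-mono T≤U (c , k , U≤) = c , k , λ a → ≤-trans (T≤U a) (U≤ a)

  ≼-refl : {S : A → ℕ} → S ≼ S
  ≼-refl {S} = 1 , 1 , λ a → ≤-trans (n≤1+n (S a)) (≤-reflexive (p (suc (S a))))
    where
    p : ∀ s → s ≡ 1 * s ^ 1
    p s = sym (trans (*-identityˡ _) (^-identityʳ s))

  ≼-const : {S : A → ℕ} → ∀ n → (λ _ → n) ≼ S
  ≼-const n = n , 0 , λ a → ≤-reflexive (sym (*-identityʳ n))

  ≼-+ : {T U S : A → ℕ} → T ≼ S → U ≼ S → (λ a → T a + U a) ≼ S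
  ≼-+ {S = S} (c , k , T≤) (d , l , U≤) = c + d , k + l , λ a →
    let s = suc (S a) in
    ≤-trans (+-mono-≤
      (≤-trans (T≤ a) (*-monoʳ-≤ c (^-monoʳ-≤ s (m≤m+n k l))))
      (≤-trans (U≤ a) (*-monoʳ-≤ d (^-monoʳ-≤ s (m≤n+m l k)))))
      (≤-reflexive (sym (*-distribʳ-+ (s ^ (k + l)) c d)))

  ≼-* : {T U S : A → ℕ} → T ≼ S → U ≼ S → (λ a → T a * U a) ≼ S
  ≼-* {S = S} (c , k , T≤) (d , l , U≤) = c * d , k + l , λ a →
    let s = suc (S a) in
    ≤-trans (*-mono-≤ (T≤ a) (U≤ a))
      (≤-reflexive (trans (p c (s ^ k) d (s ^ l))
                          (cong (c * d *_) (sym (^-distribˡ-+-* s k l)))))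
    where
    p : ∀ a b c d → a * b * (c * d) ≡ a * c * (b * d)
    p = solve-∀

  ≼-^ : {T S : A → ℕ} → T ≼ S → ∀ k → (λ a → T a ^ k) ≼ S
  ≼-^ T≼S zero    = ≼-const 1
  ≼-^ T≼S (suc k) = ≼-* T≼S (≼-^ T≼S k)

  ≼-trans : {T U S : A → ℕ} → T ≼ U → U ≼ S → T ≼ S
  ≼-trans (c , k , T≤) U≼S =
    ≼-mono T≤ (≼-* (≼-const c) (≼-^ (≼-+ (≼-const 1) U≼S) k))

≼-∘ : {A B : Set} {T S : A → ℕ} → T ≼ S → (g : B → A) → T ∘ g ≼ S ∘ g
≼-∘ (c , k , T≤) g = c , k , λ b → T≤ (g b)

size-positive : ∀ t → 1 ≤ size t
size-positive leaf       = s≤s z≤n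
size-positive (node _ _) = s≤s z≤n

-- Polynomial-time functions on trees

hdᵀ tlᵀ : Tree → Tree
hdᵀ leaf       = leaf
hdᵀ (node s t) = s
tlᵀ leaf       = leaf
tlᵀ (node s t) = t

size-hdᵀ : ∀ t → size (hdᵀ t) ≤ size t
size-hdᵀ leaf       = ≤-refl
size-hdᵀ (node s t) = m≤n⇒m≤1+n (m≤m+n (size s) (size t))

size-tlᵀ : ∀ t → size (tlᵀ t) ≤ size t
size-tlᵀ leaf       = ≤-refl
size-tlᵀ (node s t) = m≤n⇒m≤1+n (m≤n+m (size t) (size s))

ifᵀ : {A : Set} → Tree → A → A → A
ifᵀ leaf       a b = b
ifᵀ (node _ _) a b = a

-- Output sizes are bounded separately from running times: sharing lets a
-- program build a tree of exponential size in linearly many steps.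
record PolyFn : Set where
  field
    ⟦_⟧   : Tree → Tree
    prog  : Program
    time  : Tree → ℕ
    runs  : ∀ x → prog ∶ x ⇓ ⟦_⟧ x [ time x ]
    time≼ : time ≼ size
    size≼ : size ∘ ⟦_⟧ ≼ size

open PolyFn public

idᶠ nilᶠ hdᶠ tlᶠ : PolyFn
idᶠ = record
  { ⟦_⟧ = λ x → x ; prog = id ; time = λ _ → 1 ; runs = λ _ → id⇓
  ; time≼ = ≼-const 1 ; size≼ = ≼-refl }
nilᶠ = record
  { ⟦_⟧ = λ _ → leaf ; prog = nil ; time = λ _ → 1 ; runs = λ _ → nil⇓
  ; time≼ = ≼-const 1 ; size≼ = ≼-const 1 }
hdᶠ = record
  { ⟦_⟧ = hdᵀ ; prog = hd ; time = λ _ → 1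
  ; runs = λ { leaf → hd-leaf⇓ ; (node _ _) → hd-node⇓ }
  ; time≼ = ≼-const 1 ; size≼ = ≼-mono size-hdᵀ ≼-refl }
tlᶠ = record
  { ⟦_⟧ = tlᵀ ; prog = tl ; time = λ _ → 1
  ; runs = λ { leaf → tl-leaf⇓ ; (node _ _) → tl-node⇓ }
  ; time≼ = ≼-const 1 ; size≼ = ≼-mono size-tlᵀ ≼-refl }

infix  6 ⟨_,_⟩
infixr 5 _⨾ᶠ_

⟨_,_⟩ : PolyFn → PolyFn → PolyFn
⟨ f , g ⟩ = record
  { ⟦_⟧   = λ x → node (⟦ f ⟧ x) (⟦ g ⟧ x)
  ; prog  = cons (prog f) (prog g)
  ; time  = λ x → 1 + time f x + time g x
  ; runs  = λ x → cons⇓ (runs f x) (runs g x)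
  ; time≼ = ≼-+ (≼-+ (≼-const 1) (time≼ f)) (time≼ g)
  ; size≼ = ≼-+ (≼-+ (≼-const 1) (size≼ f)) (size≼ g) }

_⨾ᶠ_ : PolyFn → PolyFn → PolyFn
f ⨾ᶠ g = record
  { ⟦_⟧   = λ x → ⟦ g ⟧ (⟦ f ⟧ x)
  ; prog  = prog f ⨾ prog g
  ; time  = λ x → 1 + time f x + time g (⟦ f ⟧ x)
  ; runs  = λ x → ⨾⇓ (runs f x) (runs g (⟦ f ⟧ x))
  ; time≼ = ≼-+ (≼-+ (≼-const 1) (time≼ f))
                (≼-trans (≼-∘ (time≼ g) ⟦ f ⟧) (size≼ f))
  ; size≼ = ≼-trans (≼-∘ (size≼ g) ⟦ f ⟧) (size≼ f) }

if⇓ : ∀ {p q r x s t u y z} c →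
      p ∶ x ⇓ c [ s ] → q ∶ x ⇓ y [ t ] → r ∶ x ⇓ z [ u ] →
      (if p then q else r) ∶ x ⇓ ifᵀ c y z [ 1 + s + ifᵀ c t u ]
if⇓ leaf       pc qy rz = if-false⇓ pc rz
if⇓ (node _ _) pc qy rz = if-true⇓ pc qy

ifᵀ-≤-+ : ∀ c m n → ifᵀ c m n ≤ m + n
ifᵀ-≤-+ leaf       m n = m≤n+m n m
ifᵀ-≤-+ (node _ _) m n = m≤m+n m n

size-ifᵀ : ∀ c s t → size (ifᵀ c s t) ≡ ifᵀ c (size s) (size t)
size-ifᵀ leaf       s t = refl
size-ifᵀ (node _ _) s t = refl

size-ifᵀ-≤ : ∀ c s t {n} → size s ≤ n → size t ≤ n → size (ifᵀ c s t) ≤ n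
size-ifᵀ-≤ leaf       s t s≤ t≤ = t≤
size-ifᵀ-≤ (node _ _) s t s≤ t≤ = s≤

ifᶠ_then_else_ : PolyFn → PolyFn → PolyFn → PolyFn
ifᶠ p then f else g = record
  { ⟦_⟧   = λ x → ifᵀ (⟦ p ⟧ x) (⟦ f ⟧ x) (⟦ g ⟧ x)
  ; prog  = if prog p then prog f else prog g
  ; time  = λ x → 1 + time p x + ifᵀ (⟦ p ⟧ x) (time f x) (time g x)
  ; runs  = λ x → if⇓ (⟦ p ⟧ x) (runs p x) (runs f x) (runs g x)
  ; time≼ = ≼-+ (≼-+ (≼-const 1) (time≼ p))
                (≼-mono (λ x → ifᵀ-≤-+ (⟦ p ⟧ x) _ _) (≼-+ (time≼ f) (time≼ g)))
  ; size≼ = ≼-mono (λ x → ≤-trans (≤-reflexive (size-ifᵀ (⟦ p ⟧ x) _ _))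
                                  (ifᵀ-≤-+ (⟦ p ⟧ x) _ _))
                   (≼-+ (size≼ f) (size≼ g)) }

constᶠ : Tree → PolyFn
constᶠ leaf       = nilᶠ
constᶠ (node s t) = ⟨ constᶠ s , constᶠ t ⟩

⟦constᶠ⟧ : ∀ t {x} → ⟦ constᶠ t ⟧ x ≡ t
⟦constᶠ⟧ leaf       = refl
⟦constᶠ⟧ (node s t) = cong₂ node (⟦constᶠ⟧ s) (⟦constᶠ⟧ t)

-- Folds over the right spine of a tree.  The step function receives
-- (environment, element, accumulator); its output may exceed the accumulator
-- only by an amount independent of the accumulator, which is what keeps
-- iterated sizes polynomial.

foldlᵀ foldrᵀ : (Tree → Tree) → Tree → Tree → Tree → Tree
foldlᵀ g e a leaf        = a
foldlᵀ g e a (node x xs) = foldlᵀ g e (g (node e (node x a))) xs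
foldrᵀ g e a leaf        = a
foldrᵀ g e a (node x xs) = g (node e (node x (foldrᵀ g e a xs)))

AdditiveGrowth : (Tree → Tree) → Set
AdditiveGrowth g = ∃[ D ] (D ≼ size ×
  (∀ e x a → size (g (node e (node x a))) ≤ size a + D (node e x)))

module _ (G : PolyFn) (growth : AdditiveGrowth ⟦ G ⟧) where

  private
    g = ⟦ G ⟧

    -- The loop state is `node xs (node a e)`: with the remaining list in front, the loop test is
    -- simply `hd`. `arguments` brings the input `node e (node a xs)` into this order.
    arguments body : PolyFn
    arguments = ⟨ tlᶠ ⨾ᶠ tlᶠ , ⟨ tlᶠ ⨾ᶠ hdᶠ , hdᶠ ⟩ ⟩
    body = ⟨ hdᶠ ⨾ᶠ tlᶠ
           , ⟨ ⟨ tlᶠ ⨾ᶠ tlᶠ , ⟨ hdᶠ ⨾ᶠ hdᶠ , tlᶠ ⨾ᶠ hdᶠ ⟩ ⟩ ⨾ᶠ G , tlᶠ ⨾ᶠ tlᶠ ⟩ ⟩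

    loop : Program
    loop = while hd loop prog body

    loop-time : Tree → Tree → Tree → ℕ
    loop-time e a leaf        = 2
    loop-time e a (node x xs) =
      2 + time body (node (node x xs) (node a e)) +
      loop-time e (g (node e (node x a))) xs

    loop⇓ : ∀ e a xs → loop ∶ node xs (node a e)
            ⇓ node leaf (node (foldlᵀ g e a xs) e) [ loop-time e a xs ]
    loop⇓ e a leaf        = while-stop⇓ hd-node⇓
    loop⇓ e a (node x xs) = while-step⇓ hd-node⇓
      (runs body (node (node x xs) (node a e))) (loop⇓ e _ xs)

    D : Tree → ℕ
    D = proj₁ growth
    cᴰ = proj₁ (proj₁ (proj₂ growth))
    kᴰ = proj₁ (proj₂ (proj₁ (proj₂ growth)))
    D≤ = proj₂ (proj₂ (proj₁ (proj₂ growth)))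
    grows = proj₂ (proj₂ growth)
    cᵀ = proj₁ (time≼ G)
    kᵀ = proj₁ (proj₂ (time≼ G))
    time≤ = proj₂ (proj₂ (time≼ G))

    -- Here `s` bounds both the environment and the list. An environment-element pair then has size
    -- at most `1 + s + s`, there are at most `s` elements, and a step input `node e (node x a)` has
    -- size at most `2 + s + s + accBound s`.
    growthBound accBound stepBound : ℕ → ℕ
    growthBound s = cᴰ * suc (1 + s + s) ^ kᴰ
    accBound s    = s + s * growthBound s
    stepBound s   = cᵀ * suc (2 + s + s + accBound s) ^ kᵀ

    D-bound : ∀ {s} e x → size e ≤ s → size x ≤ s → D (node e x) ≤ growthBound s
    D-bound e x e≤ x≤ = ≤-trans (D≤ (node e x))
      (*-monoʳ-≤ cᴰ (^-monoˡ-≤ kᴰ (s≤s (s≤s (+-mono-≤ e≤ x≤)))))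

    -- A potential argument: consuming an element lowers the size of the list by at least one, which
    -- releases `growthBound s` for the growth of the accumulator.
    acc-step : ∀ {s u} e x xs a → size e ≤ s → size (node x xs) ≤ s →
               size a + size (node x xs) * growthBound s ≤ u →
               size (g (node e (node x a))) + size xs * growthBound s ≤ u
    acc-step {s} {u} e x xs a e≤ xs≤ inv = begin
      size (g (node e (node x a))) + size xs * d
        ≤⟨ +-monoˡ-≤ _ (≤-trans (grows e x a) (+-monoʳ-≤ (size a) (D-bound e x e≤ x≤))) ⟩
      size a + d + size xs * d       ≡⟨ +-assoc (size a) d _ ⟩
      size a + suc (size xs) * d
        ≤⟨ +-monoʳ-≤ (size a) (*-monoˡ-≤ d (s≤s (m≤n+m (size xs) (size x)))) ⟩
      size a + size (node x xs) * d  ≤⟨ inv ⟩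
      u                              ∎
      where
      open ≤-Reasoning
      d = growthBound s
      x≤ = ≤-trans (size-hdᵀ (node x xs)) xs≤

    loop-time-≤ : ∀ {s} e a xs → size e ≤ s → size xs ≤ s →
                  size a + size xs * growthBound s ≤ accBound s →
                  loop-time e a xs ≤ size xs * (22 + stepBound s)
    loop-time-≤ e a leaf e≤ xs≤ inv = s≤s (s≤s z≤n)
    loop-time-≤ {s} e a (node x xs) e≤ xs≤ inv = begin
      2 + time body (node (node x xs) (node a e)) + loop-time e a′ xs
        ≤⟨ +-mono-≤ (≤-reflexive (p (time G input)))
             (loop-time-≤ e a′ xs e≤ (≤-trans (size-tlᵀ (node x xs)) xs≤)
               (acc-step e x xs a e≤ xs≤ inv)) ⟩
      22 + time G input + size xs * w
        ≤⟨ +-monoˡ-≤ (size xs * w) (+-monoʳ-≤ 22 step≤) ⟩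
      suc (size xs) * w
        ≤⟨ *-monoˡ-≤ w (s≤s (m≤n+m (size xs) (size x))) ⟩
      size (node x xs) * w ∎
      where
      open ≤-Reasoning
      w = 22 + stepBound s
      input = node e (node x a)
      a′ = g input
      -- The 22 is the cost of one iteration apart from `G`: the loop rule, its test and the
      -- rearrangements in `body`.
      p : ∀ t → 2 + (1 + 3 + (1 + (1 + (1 + 3 + (1 + 3 + 3)) + t) + 3)) ≡ 22 + t
      p = solve-∀
      a≤ : size a ≤ accBound s
      a≤ = ≤-trans (m≤m+n (size a) _) inv
      x≤ = ≤-trans (size-hdᵀ (node x xs)) xs≤
      q : ∀ e x a → 1 + e + (1 + x + a) ≡ 2 + e + x + a
      q = solve-∀
      step≤ : time G input ≤ stepBound s
      step≤ = ≤-trans (time≤ input) (*-monoʳ-≤ cᵀ (^-monoˡ-≤ kᵀ (s≤s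
        (≤-trans (≤-reflexive (q (size e) (size x) (size a)))
                 (+-mono-≤ (+-mono-≤ (+-monoʳ-≤ 2 e≤) x≤) a≤)))))

    size-foldlᵀ : ∀ {s u} e a xs → size e ≤ s → size xs ≤ s →
                  size a + size xs * growthBound s ≤ u → size (foldlᵀ g e a xs) ≤ u
    size-foldlᵀ e a leaf        e≤ xs≤ inv = ≤-trans (m≤m+n (size a) _) inv
    size-foldlᵀ e a (node x xs) e≤ xs≤ inv =
      size-foldlᵀ e _ xs e≤ (≤-trans (size-tlᵀ (node x xs)) xs≤)
        (acc-step e x xs a e≤ xs≤ inv)

    accBound≼ : accBound ∘ size ≼ size
    accBound≼ = ≼-+ ≼-refl (≼-* ≼-refl
      (≼-* (≼-const cᴰ) (≼-^ (≼-+ (≼-+ (≼-const 2) ≼-refl) ≼-refl) kᴰ)))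

    stepBound≼ : stepBound ∘ size ≼ size
    stepBound≼ = ≼-* (≼-const cᵀ)
      (≼-^ (≼-+ (≼-+ (≼-+ (≼-const 3) ≼-refl) ≼-refl) accBound≼) kᵀ)

    initial : ∀ i → size (hdᵀ (tlᵀ i)) + size (tlᵀ (tlᵀ i)) * growthBound (size i)
                    ≤ accBound (size i)
    initial i = +-mono-≤ (≤-trans (size-hdᵀ (tlᵀ i)) (size-tlᵀ i))
      (*-monoˡ-≤ _ (≤-trans (size-tlᵀ (tlᵀ i)) (size-tlᵀ i)))

  foldlᶠ : PolyFn
  foldlᶠ = record
    { ⟦_⟧   = λ i → foldlᵀ g (hdᵀ i) (hdᵀ (tlᵀ i)) (tlᵀ (tlᵀ i))
    ; prog  = prog arguments ⨾ loop ⨾ tl ⨾ hd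
    ; time  = λ i → 1 + time arguments i +
                (1 + loop-time (hdᵀ i) (hdᵀ (tlᵀ i)) (tlᵀ (tlᵀ i)) + 3)
    ; runs  = λ i → ⨾⇓ (runs arguments i)
                (⨾⇓ (loop⇓ (hdᵀ i) (hdᵀ (tlᵀ i)) (tlᵀ (tlᵀ i)))
                    (⨾⇓ tl-node⇓ hd-node⇓))
    ; time≼ = ≼-+ (≼-+ (≼-const 1) (time≼ arguments))
                (≼-+ (≼-+ (≼-const 1)
                  (≼-mono (λ i → ≤-trans
                      (loop-time-≤ (hdᵀ i) _ (tlᵀ (tlᵀ i)) (size-hdᵀ i) (tltl≤ i) (initial i))
                      (*-monoˡ-≤ _ (tltl≤ i)))
                    (≼-* ≼-refl (≼-+ (≼-const 22) stepBound≼))))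
                  (≼-const 3))
    ; size≼ = ≼-mono (λ i → size-foldlᵀ (hdᵀ i) _ (tlᵀ (tlᵀ i))
                              (size-hdᵀ i) (tltl≤ i) (initial i))
                     accBound≼ }
    where
    tltl≤ : ∀ i → size (tlᵀ (tlᵀ i)) ≤ size i
    tltl≤ i = ≤-trans (size-tlᵀ (tlᵀ i)) (size-tlᵀ i)

-- List operations as polynomial-time programs

reverseᵀ : Tree → Tree → Tree
reverseᵀ = foldlᵀ tlᵀ leaf

-- The loop consumes a list from the front, so a right fold is run as a left fold over the reversed
-- list; the accumulator `b` is general for the sake of the induction. In `reverseᵀ` the step `tlᵀ`
-- acts as cons, since it sends `node e (node x a)` to `node x a`.
foldlᵀ-reverseᵀ : ∀ g e a b xs →
  foldlᵀ g e a (reverseᵀ b xs) ≡ foldlᵀ g e (foldrᵀ g e a xs) b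
foldlᵀ-reverseᵀ g e a b leaf        = refl
foldlᵀ-reverseᵀ g e a b (node x xs) = foldlᵀ-reverseᵀ g e a (node x b) xs

cons-growth : AdditiveGrowth tlᵀ
cons-growth = (λ t → 1 + size t) , ≼-+ (≼-const 1) ≼-refl , λ e x a →
  ≤-trans (≤-reflexive (+-comm (1 + size x) (size a)))
    (+-monoʳ-≤ (size a) (s≤s (m≤n+m (size x) (1 + size e))))

opaque
  reverseᶠ : PolyFn
  reverseᶠ = ⟨ nilᶠ , ⟨ nilᶠ , idᶠ ⟩ ⟩ ⨾ᶠ foldlᶠ tlᶠ cons-growth

  foldrᶠ : (G : PolyFn) → AdditiveGrowth ⟦ G ⟧ → PolyFn
  foldrᶠ G growth =
    ⟨ hdᶠ , ⟨ tlᶠ ⨾ᶠ hdᶠ , tlᶠ ⨾ᶠ tlᶠ ⨾ᶠ reverseᶠ ⟩ ⟩ ⨾ᶠ foldlᶠ G growth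

  ⟦foldrᶠ⟧ : ∀ G growth e a xs →
    ⟦ foldrᶠ G growth ⟧ (node e (node a xs)) ≡ foldrᵀ ⟦ G ⟧ e a xs
  ⟦foldrᶠ⟧ G growth e a xs = foldlᵀ-reverseᵀ ⟦ G ⟧ e a leaf xs

size-append : ∀ e a xs → size (foldrᵀ tlᵀ e a xs) ≤ size a + size xs
size-append e a leaf        = m≤m+n (size a) 1
size-append e a (node x xs) = begin
  1 + size x + size (foldrᵀ tlᵀ e a xs) ≤⟨ +-monoʳ-≤ (1 + size x) (size-append e a xs) ⟩
  1 + size x + (size a + size xs)       ≡⟨ +-assoc (1 + size x) (size a) (size xs) ⟨
  1 + size x + size a + size xs         ≡⟨ cong (_+ size xs) (+-comm (1 + size x) (size a)) ⟩
  size a + (1 + size x) + size xs       ≡⟨ +-assoc (size a) (1 + size x) (size xs) ⟩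
  size a + (1 + size x + size xs)       ∎
  where open ≤-Reasoning

opaque
  appendᶠ : PolyFn
  appendᶠ = ⟨ nilᶠ , ⟨ tlᶠ , hdᶠ ⟩ ⟩ ⨾ᶠ foldrᶠ tlᶠ cons-growth

  ⟦appendᶠ⟧ᵀ : ∀ xs ys → ⟦ appendᶠ ⟧ (node xs ys) ≡ foldrᵀ tlᵀ leaf ys xs
  ⟦appendᶠ⟧ᵀ xs ys = ⟦foldrᶠ⟧ tlᶠ cons-growth leaf ys xs

⟦appendᶠ⟧ : {A : Set} (enc : A → Tree) (xs ys : List A) →
  ⟦ appendᶠ ⟧ (node (encodeList enc xs) (encodeList enc ys)) ≡ encodeList enc (xs ++ ys)
⟦appendᶠ⟧ enc xs ys = trans (⟦appendᶠ⟧ᵀ _ _) (go xs)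
  where
  go : ∀ xs → foldrᵀ tlᵀ leaf (encodeList enc ys) (encodeList enc xs)
              ≡ encodeList enc (xs ++ ys)
  go []       = refl
  go (x ∷ xs) = cong (node (enc x)) (go xs)

private
  prependᶠ : PolyFn → PolyFn
  prependᶠ g = ⟨ ⟨ hdᶠ , tlᶠ ⨾ᶠ hdᶠ ⟩ ⨾ᶠ g , tlᶠ ⨾ᶠ tlᶠ ⟩ ⨾ᶠ appendᶠ

  -- Appending adds at most the size of the output of `g`, and `g` does not see the accumulator.
  prepend-growth : ∀ g → AdditiveGrowth ⟦ prependᶠ g ⟧
  prepend-growth g = (size ∘ ⟦ g ⟧) , size≼ g , λ e x a →
    ≤-trans (≤-reflexive (cong size (⟦appendᶠ⟧ᵀ (⟦ g ⟧ (node e x)) a)))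
            (size-append leaf a (⟦ g ⟧ (node e x)))

opaque
  concatMapᶠ : PolyFn → PolyFn
  concatMapᶠ g = ⟨ hdᶠ , ⟨ nilᶠ , tlᶠ ⟩ ⟩ ⨾ᶠ foldrᶠ (prependᶠ g) (prepend-growth g)

  ⟦concatMapᶠ⟧ : {A B : Set} {enc : A → Tree} {enc′ : B → Tree} →
    ∀ g {e} {h : A → List B} →
    (∀ x → ⟦ g ⟧ (node e (enc x)) ≡ encodeList enc′ (h x)) → ∀ xs →
    ⟦ concatMapᶠ g ⟧ (node e (encodeList enc xs)) ≡ encodeList enc′ (concatMap h xs)
  ⟦concatMapᶠ⟧ {enc = enc} {enc′} g {e} {h} g≡h xs =
    trans (⟦foldrᶠ⟧ (prependᶠ g) (prepend-growth g) e leaf (encodeList enc xs)) (go xs)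
    where
    go : ∀ xs → foldrᵀ ⟦ prependᶠ g ⟧ e leaf (encodeList enc xs)
                ≡ encodeList enc′ (concatMap h xs)
    go []       = refl
    go (x ∷ xs) = trans (cong₂ (λ s t → ⟦ appendᶠ ⟧ (node s t)) (g≡h x) (go xs))
                        (⟦appendᶠ⟧ enc′ (h x) (concatMap h xs))

mapᶠ : PolyFn → PolyFn
mapᶠ g = concatMapᶠ ⟨ g , nilᶠ ⟩

⟦mapᶠ⟧ : {A B : Set} {enc : A → Tree} {enc′ : B → Tree} → ∀ g {e} {h : A → B} →
  (∀ x → ⟦ g ⟧ (node e (enc x)) ≡ enc′ (h x)) → ∀ xs →
  ⟦ mapᶠ g ⟧ (node e (encodeList enc xs)) ≡ encodeList enc′ (map h xs)
⟦mapᶠ⟧ {enc′ = enc′} g {h = h} g≡h xs = trans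
  (⟦concatMapᶠ⟧ _ {h = λ x → h x ∷ []} (λ x → cong (λ t → node t leaf) (g≡h x)) xs)
  (cong (encodeList enc′) (go xs))
  where
  go : ∀ xs → concatMap (λ x → h x ∷ []) xs ≡ map h xs
  go []       = refl
  go (x ∷ xs) = cong (h x ∷_) (go xs)

trueᶠ notᶠ : PolyFn
trueᶠ = ⟨ nilᶠ , nilᶠ ⟩
notᶠ  = ifᶠ idᶠ then nilᶠ else trueᶠ

⟦notᶠ⟧ : ∀ b → ⟦ notᶠ ⟧ (encodeBool b) ≡ encodeBool (not b)
⟦notᶠ⟧ false = refl
⟦notᶠ⟧ true  = refl

filterᶠ : PolyFn → PolyFn
filterᶠ p = concatMapᶠ (ifᶠ p then ⟨ tlᶠ , nilᶠ ⟩ else nilᶠ)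

anyᶠ : PolyFn → PolyFn
anyᶠ p = ifᶠ filterᶠ p then trueᶠ else nilᶠ

module _ {A : Set} {enc : A → Tree} {P : Pred A 0ℓ} (P? : Decidable P) where

  ⟦filterᶠ⟧ : ∀ p {e} → (∀ x → ⟦ p ⟧ (node e (enc x)) ≡ encodeBool (does (P? x))) → ∀ xs →
    ⟦ filterᶠ p ⟧ (node e (encodeList enc xs)) ≡ encodeList enc (filter P? xs)
  ⟦filterᶠ⟧ p {e} p≡P xs = trans
    (⟦concatMapᶠ⟧ _ {h = keep} step xs) (cong (encodeList enc) (go xs))
    where
    keep : A → List A
    keep x = ifᵇ does (P? x) then x ∷ [] else []
    step : ∀ x → ifᵀ (⟦ p ⟧ (node e (enc x))) (node (enc x) leaf) leaf
                 ≡ encodeList enc (keep x)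
    step x rewrite p≡P x with does (P? x)
    ... | true  = refl
    ... | false = refl
    go : ∀ xs → concatMap keep xs ≡ filter P? xs
    go []       = refl
    go (x ∷ xs) with does (P? x)
    ... | true  = cong (x ∷_) (go xs)
    ... | false = go xs

  ⟦anyᶠ⟧ : ∀ p {e} → (∀ x → ⟦ p ⟧ (node e (enc x)) ≡ encodeBool (does (P? x))) → ∀ xs →
    ⟦ anyᶠ p ⟧ (node e (encodeList enc xs)) ≡ encodeBool (does (any? P? xs))
  ⟦anyᶠ⟧ p p≡P xs = trans
    (cong (λ t → ifᵀ t (node leaf leaf) leaf) (⟦filterᶠ⟧ p p≡P xs)) (go xs)
    where
    go : ∀ xs → ifᵀ (encodeList enc (filter P? xs)) (node leaf leaf) leaf
                ≡ encodeBool (does (any? P? xs))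
    go []       = refl
    go (x ∷ xs) with does (P? x)
    ... | true  = refl
    ... | false = go xs

private
  -- The accumulator of the comparison is node leaf v while the part of the
  -- first variable read so far is a prefix, with v the unread rest of the
  -- second variable, and leaf once a mismatch has been found.
  stepᶠ finishᶠ : PolyFn
  stepᶠ = ifᶠ tlᶠ ⨾ᶠ tlᶠ
    then (ifᶠ tlᶠ ⨾ᶠ tlᶠ ⨾ᶠ tlᶠ
      then (ifᶠ (ifᶠ tlᶠ ⨾ᶠ hdᶠ then y else (y ⨾ᶠ notᶠ))
        then ⟨ nilᶠ , tlᶠ ⨾ᶠ tlᶠ ⨾ᶠ tlᶠ ⨾ᶠ tlᶠ ⟩ else nilᶠ)
      else nilᶠ)
    else nilᶠ
    where y = tlᶠ ⨾ᶠ tlᶠ ⨾ᶠ tlᶠ ⨾ᶠ hdᶠ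
  finishᶠ = ifᶠ idᶠ then (tlᶠ ⨾ᶠ notᶠ) else nilᶠ

opaque
  eqᶠ : PolyFn
  eqᶠ = ⟨ nilᶠ , ⟨ ⟨ nilᶠ , tlᶠ ⟩ , hdᶠ ⟩ ⟩ ⨾ᶠ
        foldlᶠ stepᶠ ((λ _ → 2) , ≼-const 2 , grows) ⨾ᶠ finishᶠ
    where
    leaf≤ : ∀ a → 1 ≤ size a + 2
    leaf≤ a = ≤-trans (s≤s z≤n) (m≤n+m 2 (size a))
    grows : ∀ e x a → size (⟦ stepᶠ ⟧ (node e (node x a))) ≤ size a + 2
    grows e x a = size-ifᵀ-≤ a _ _
      (size-ifᵀ-≤ (tlᵀ a) _ _
        (size-ifᵀ-≤ (ifᵀ x (hdᵀ (tlᵀ a)) (⟦ notᶠ ⟧ (hdᵀ (tlᵀ a)))) _ _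
          (≤-trans (≤-reflexive (+-comm 2 (size (tlᵀ (tlᵀ a)))))
            (+-monoˡ-≤ 2 (≤-trans (size-tlᵀ (tlᵀ a)) (size-tlᵀ a))))
          (leaf≤ a))
        (leaf≤ a))
      (leaf≤ a)

  ⟦eqᶠ⟧ : ∀ u v → ⟦ eqᶠ ⟧ (node (encodeVar u) (encodeVar v)) ≡ encodeBool (does (u ≟ⱽ v))
  ⟦eqᶠ⟧ u v = go u v
    where
    mismatch : ∀ u → foldlᵀ ⟦ stepᶠ ⟧ leaf leaf (encodeVar u) ≡ leaf
    mismatch []      = refl
    mismatch (_ ∷ u) = mismatch u
    go : ∀ u v → ⟦ finishᶠ ⟧ (foldlᵀ ⟦ stepᶠ ⟧ leaf (node leaf (encodeVar v)) (encodeVar u))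
                 ≡ encodeBool (does (u ≟ⱽ v))
    go []          []          = refl
    go []          (y ∷ v)     = refl
    go (x ∷ u)     []          = cong ⟦ finishᶠ ⟧ (mismatch u)
    go (false ∷ u) (false ∷ v) = go u v
    go (false ∷ u) (true ∷ v)  = cong ⟦ finishᶠ ⟧ (mismatch u)
    go (true ∷ u)  (false ∷ v) = cong ⟦ finishᶠ ⟧ (mismatch u)
    go (true ∷ u)  (true ∷ v)  = go u v

memberᶠ : PolyFn
memberᶠ = anyᶠ eqᶠ

⟦memberᶠ⟧ : ∀ v xs →
  ⟦ memberᶠ ⟧ (node (encodeVar v) (encodeList encodeVar xs)) ≡ encodeBool (does (v ∈? xs))
⟦memberᶠ⟧ v xs = ⟦anyᶠ⟧ (v ≟ⱽ_) eqᶠ (⟦eqᶠ⟧ v) xs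

-- Counting variables

module _ {A : Set} where

  Unique-⊆-length : {xs ys : List A} → Unique xs → xs ⊆ ys → length xs ≤ length ys
  Unique-⊆-length {[]} u xs⊆ys = z≤n
  Unique-⊆-length {x ∷ xs} (x∉xs ∷ u) xs⊆ys with ∈-∃++ (xs⊆ys (here refl))
  ... | as , bs , refl = begin
    suc (length xs)              ≤⟨ s≤s (Unique-⊆-length u sub) ⟩
    suc (length (as ++ bs))      ≡⟨ cong suc (List.length-++ as) ⟩
    suc (length as + length bs)  ≡⟨ +-suc (length as) (length bs) ⟨
    length as + suc (length bs)  ≡⟨ List.length-++ as ⟨
    length (as ++ x ∷ bs)        ∎
    where
    open ≤-Reasoning
    sub : xs ⊆ as ++ bs
    sub {v} v∈ with ∈-++⁻ as (xs⊆ys (there v∈))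
    ... | inj₁ v∈as         = ∈-++⁺ˡ v∈as
    ... | inj₂ (there v∈bs) = ∈-++⁺ʳ as v∈bs
    ... | inj₂ (here refl)  = ⊥-elim (All.lookup x∉xs v∈ refl)

card-⊆ : ∀ {xs ys} → xs ⊆ ys → card xs ≤ length ys
card-⊆ {xs} xs⊆ys = Unique-⊆-length (deduplicate-! xs) (xs⊆ys ∘ ∈-deduplicate⁻ _≟ⱽ_ xs)

card-Unique : ∀ {xs} → Unique xs → card xs ≡ length xs
card-Unique {xs} u = ≤-antisym (card-⊆ {xs} (λ v∈ → v∈))
  (Unique-⊆-length u (∈-deduplicate⁺ _≟ⱽ_))

-- `ds` followed by the deduplicated `ws` is a duplicate-free list of the variables of `vs`; mutual
-- inclusion with the deduplicated `vs` equates the lengths.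
card-∖ : ∀ {ds ws vs} → Unique ds → ds ⊆ vs → ws ⊆ vs →
         (∀ {v} → v ∈ ws → v ∉ ds) → (∀ {v} → v ∈ vs → v ∈ ds ⊎ v ∈ ws) →
         card ws ≡ card vs ∸ length ds
card-∖ {ds} {ws} {vs} u ds⊆ ws⊆ disj cover = sym (begin
  card vs ∸ length ds                ≡⟨ cong (_∸ length ds) total ⟩
  length ds + card ws ∸ length ds    ≡⟨ m+n∸m≡n (length ds) (card ws) ⟩
  card ws                            ∎)
  where
  open ≡-Reasoning
  all-unique : Unique (ds ++ deduplicate _≟ⱽ_ ws)
  all-unique = Unique.++⁺ u (deduplicate-! ws)
    (λ (v∈ds , v∈ws) → disj (∈-deduplicate⁻ _≟ⱽ_ ws v∈ws) v∈ds)
  ⊆→ : ds ++ deduplicate _≟ⱽ_ ws ⊆ deduplicate _≟ⱽ_ vs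
  ⊆→ = ∈-deduplicate⁺ _≟ⱽ_ ∘
    [ ds⊆ , ws⊆ ∘ ∈-deduplicate⁻ _≟ⱽ_ ws ]′ ∘ ∈-++⁻ ds
  ⊆← : deduplicate _≟ⱽ_ vs ⊆ ds ++ deduplicate _≟ⱽ_ ws
  ⊆← = [ ∈-++⁺ˡ , ∈-++⁺ʳ ds ∘ ∈-deduplicate⁺ _≟ⱽ_ ]′ ∘ cover ∘ ∈-deduplicate⁻ _≟ⱽ_ vs
  total : card vs ≡ length ds + card ws
  total = trans (≤-antisym (Unique-⊆-length (deduplicate-! vs) ⊆←)
                           (Unique-⊆-length all-unique ⊆→))
                (List.length-++ ds)

-- Eliminating the variables of a partial assignment

PartialAssignment : Set
PartialAssignment = List (Var × Bool)

dom : PartialAssignment → List Var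
dom = map proj₁

Agrees : Assignment → PartialAssignment → Set
Agrees σ = All (λ (v , b) → σ v ≡ b)

-- In a pair (x , y) of constants, x stands for false and y for true.

constant : Var × Var → Bool → Var
constant (x , y) b = ifᵇ b then y else x

substitute : Var × Var → PartialAssignment → Var → Var
substitute xy []            v = v
substitute xy ((w , b) ∷ β) v =
  ifᵇ does (v ≟ⱽ w) then constant xy b else substitute xy β v

module _ {xy : Var × Var} where

  -- Agreement of `τ` with `σ` is demanded only off `dom β`, because `τ` has to redefine the two
  -- reused names. On `dom β` the value of `σ` is recorded in `β`, and `τ` is consulted only at the
  -- constants.
  substitute-model : ∀ {σ τ : Assignment} {β} →
    τ (proj₁ xy) ≡ false → τ (proj₂ xy) ≡ true →
    Agrees σ β → ∀ v → (v ∉ dom β → τ v ≡ σ v) → τ (substitute xy β v) ≡ σ v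
  substitute-model x≡ y≡ [] v out = out λ ()
  substitute-model {β = (w , b) ∷ β} x≡ y≡ (σw ∷ agree) v out with v ≟ⱽ w
  substitute-model {β = (w , false) ∷ β} x≡ y≡ (σw ∷ agree) v out | yes refl = trans x≡ (sym σw)
  substitute-model {β = (w , true) ∷ β}  x≡ y≡ (σw ∷ agree) v out | yes refl = trans y≡ (sym σw)
  ... | no v≢w = substitute-model x≡ y≡ agree v
    (λ v∉ → out λ { (here v≡w) → v≢w v≡w ; (there v∈) → v∉ v∈ })

  -- `substitute` uses the first binding it meets. Hence `α` takes precedence over `γ`, and
  -- uniqueness excludes that one binding of `α` shadows another.
  substitute-agrees : ∀ {τ : Assignment} α γ → Unique (dom α) →
    τ (proj₁ xy) ≡ false → τ (proj₂ xy) ≡ true →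
    Agrees (τ ∘ substitute xy (α ++ γ)) α
  substitute-agrees {τ} α γ unique x≡ y≡ = All.tabulate (λ {(v , b)} → go α unique v b)
    where
    constant≡ : ∀ b → τ (constant xy b) ≡ b
    constant≡ false = x≡
    constant≡ true  = y≡
    go : ∀ α → Unique (dom α) → ∀ v b → (v , b) ∈ᵖ α → τ (substitute xy (α ++ γ) v) ≡ b
    go ((w , c) ∷ α) (w∉ ∷ u) v b v∈ with v ≟ⱽ w
    go ((w , c) ∷ α) (w∉ ∷ u) v b (here refl) | yes _    = constant≡ b
    go ((w , c) ∷ α) (w∉ ∷ u) v b (here refl) | no v≢v   = ⊥-elim (v≢v refl)
    go ((w , c) ∷ α) (w∉ ∷ u) v b (there v∈)  | yes refl =
      ⊥-elim (All.lookup w∉ (∈-map⁺ proj₁ v∈) refl)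
    go ((w , c) ∷ α) (w∉ ∷ u) v b (there v∈)  | no _     = go α u v b v∈

  substitute-∈ : ∀ β {v} → v ∈ dom β →
    substitute xy β v ≡ proj₁ xy ⊎ substitute xy β v ≡ proj₂ xy
  substitute-∈ ((w , b) ∷ β) {v} v∈ with v ≟ⱽ w
  substitute-∈ ((w , false) ∷ β) v∈          | yes _  = inj₁ refl
  substitute-∈ ((w , true) ∷ β)  v∈          | yes _  = inj₂ refl
  substitute-∈ ((w , b) ∷ β)     (here v≡w)  | no v≢w = ⊥-elim (v≢w v≡w)
  substitute-∈ ((w , b) ∷ β)     (there v∈)  | no v≢w = substitute-∈ β v∈

  substitute-∉ : ∀ β {v} → v ∉ dom β → substitute xy β v ≡ v
  substitute-∉ []            v∉ = refl
  substitute-∉ ((w , b) ∷ β) {v} v∉ with v ≟ⱽ w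
  ... | yes v≡w = ⊥-elim (v∉ (here v≡w))
  ... | no  _   = substitute-∉ β (v∉ ∘ there)

-- The two variables that play the constants are the first two distinct ones of
-- a list, if there are any.  The fallback names may clash with variables in
-- use; this is harmless because the given bindings take precedence.

firstOr[] : List Var → Var
firstOr[] []      = []
firstOr[] (v ∷ _) = v

withSecond : Var → List Var → Var × Var
withSecond x []      = [] , true ∷ []
withSecond x (y ∷ _) = x , y

others : List Var → List Var
others vs = filter (λ v → ¬? (firstOr[] vs ≟ⱽ v)) vs

pick : List Var → Var × Var
pick vs = withSecond (firstOr[] vs) (others vs)

firstOr[]-∈ : ∀ {v vs} → v ∈ vs → firstOr[] vs ∈ vs
firstOr[]-∈ {vs = _ ∷ _} _ = here refl

data Picked (vs : List Var) : Var × Var → Set where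
  two-free : ∀ {x y} → x ∈ vs → y ∈ vs → x ≢ y → Picked vs (x , y)
  one-free : (∀ {v} → v ∈ vs → v ≡ firstOr[] vs) → Picked vs ([] , true ∷ [])

picked : ∀ vs → Picked vs (pick vs)
picked vs = go (others vs) refl
  where
  go : ∀ ws → others vs ≡ ws → Picked vs (withSecond (firstOr[] vs) ws)
  go []      eq = one-free λ {v} v∈ → same v∈ (firstOr[] vs ≟ⱽ v)
    where
    same : ∀ {v} → v ∈ vs → Dec (firstOr[] vs ≡ v) → v ≡ firstOr[] vs
    same v∈ (yes eq) = sym eq
    same v∈ (no neq) with () ← subst (_ ∈_) eq (∈-filter⁺ _ v∈ neq)
  go (y ∷ _) eq =
    let y∈ , x≢y = ∈-filter⁻ (λ v → ¬? (firstOr[] vs ≟ⱽ v)) {xs = vs}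
                     (subst (y ∈_) (sym eq) (here refl))
    in two-free (firstOr[]-∈ y∈) y∈ x≢y

pick-distinct : ∀ {vs xy} → Picked vs xy → proj₁ xy ≢ proj₂ xy
pick-distinct (two-free _ _ x≢y) = x≢y
pick-distinct (one-free _)       = λ ()

module _ {Γ : ConstraintLanguage} where

  isFalse isTrue : Var → Constraint (Γ ⁺)
  isFalse v = record { rel = ⊥ᴿ ; rel∈Γ = inj₂ (inj₁ refl) ; args = v ∷ [] }
  isTrue  v = record { rel = ⊤ᴿ ; rel∈Γ = inj₂ (inj₂ refl) ; args = v ∷ [] }

  rename : (Var → Var) → Constraint (Γ ⁺) → Constraint (Γ ⁺)
  rename ρ C = record { rel = rel ; rel∈Γ = rel∈Γ ; args = Vec.map ρ args }
    where open Constraint C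

  embed : Constraint Γ → Constraint (Γ ⁺)
  embed C = record { rel = rel ; rel∈Γ = inj₁ rel∈Γ ; args = args }
    where open Constraint C

  vars-++ : (φ χ : Formula (Γ ⁺)) → vars (φ ++ χ) ≡ vars φ ++ vars χ
  vars-++ = List.concatMap-++ _

  vars-isFalse : ∀ vs → vars (map isFalse vs) ≡ vs
  vars-isFalse []       = refl
  vars-isFalse (v ∷ vs) = cong (v ∷_) (vars-isFalse vs)

  vars-isTrue : ∀ vs → vars (map isTrue vs) ≡ vs
  vars-isTrue []       = refl
  vars-isTrue (v ∷ vs) = cong (v ∷_) (vars-isTrue vs)

  vars-embed : ∀ φ → vars (map embed φ) ≡ vars φ
  vars-embed []      = refl
  vars-embed (C ∷ φ) = cong (Vec.toList (Constraint.args C) ++_) (vars-embed φ)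

  vars-rename : ∀ ρ φ → vars (map (rename ρ) φ) ≡ map ρ (vars φ)
  vars-rename ρ []      = refl
  vars-rename ρ (C ∷ φ) = trans
    (cong₂ _++_ (Vec.toList-map ρ (Constraint.args C)) (vars-rename ρ φ))
    (sym (List.map-++ ρ (Vec.toList (Constraint.args C)) (vars φ)))

  ⊨-isFalse : ∀ σ v → σ v ≡ false → SatisfiesConstraint σ (isFalse v)
  ⊨-isFalse σ v = cong not

  ⊨-isFalse⁻ : ∀ σ v → SatisfiesConstraint σ (isFalse v) → σ v ≡ false
  ⊨-isFalse⁻ σ v p with σ v
  ... | false = refl

  ⊨-embed : ∀ {σ} φ → σ ⊨ φ → σ ⊨ map embed φ
  ⊨-embed φ = All.map⁺

  ⊨-embed⁻ : ∀ {σ} φ → σ ⊨ map embed φ → σ ⊨ φ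
  ⊨-embed⁻ φ = All.map⁻

  ⊨-rename : ∀ {σ ρ} {φ : Formula (Γ ⁺)} → (σ ∘ ρ) ⊨ φ → σ ⊨ map (rename ρ) φ
  ⊨-rename {σ} {ρ} = All.map⁺ ∘ All.map (λ {C} → trans
    (cong (holds (Constraint.rel C)) (sym (Vec.map-∘ σ ρ (Constraint.args C)))))

  ⊨-rename⁻ : ∀ {σ ρ} {φ : Formula (Γ ⁺)} → σ ⊨ map (rename ρ) φ → (σ ∘ ρ) ⊨ φ
  ⊨-rename⁻ {σ} {ρ} = All.map (λ {C} → trans
    (cong (holds (Constraint.rel C)) (Vec.map-∘ σ ρ (Constraint.args C)))) ∘ All.map⁻

Vec-map-cong-∈ : ∀ {n} {σ τ : Assignment} (vs : Vec Var n) →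
  (∀ {v} → v ∈ Vec.toList vs → σ v ≡ τ v) → Vec.map σ vs ≡ Vec.map τ vs
Vec-map-cong-∈ []       σ≡τ = refl
Vec-map-cong-∈ (v ∷ vs) σ≡τ = cong₂ _∷_ (σ≡τ (here refl)) (Vec-map-cong-∈ vs (σ≡τ ∘ there))

⊨-cong : ∀ {Γ} {σ τ : Assignment} {φ : Formula Γ} →
  (∀ {v} → v ∈ vars φ → σ v ≡ τ v) → σ ⊨ φ → τ ⊨ φ
⊨-cong σ≡τ [] = []
⊨-cong {φ = C ∷ φ} σ≡τ (σC ∷ σφ) =
  trans (cong (holds (Constraint.rel C))
    (sym (Vec-map-cong-∈ (Constraint.args C) (σ≡τ ∘ ∈-++⁺ˡ)))) σC
  ∷ ⊨-cong (σ≡τ ∘ ∈-++⁺ʳ (Vec.toList (Constraint.args C))) σφ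

-- The reduced formulas: correctness and number of variables

module _ {Γ : ConstraintLanguage} (I : AbductionInstance Γ) where
  open AbductionInstance I

  Consistent : PartialAssignment → List Var → Set
  Consistent α q = ∃[ σ ] (σ ⊨ KB × Agrees σ α × All (λ v → σ v ≡ false) q)

  Correct : PartialAssignment → Set
  Correct α = Consistent α [] × All (λ m → ¬ Consistent α (m ∷ [])) M

  allVars : List Var
  allVars = vars KB ++ H ++ M

  freeVars : PartialAssignment → List Var
  freeVars α = filter (_∉? dom α) allVars

  freeVars⁺ : ∀ α {v} → v ∈ allVars → v ∉ dom α → v ∈ freeVars α
  freeVars⁺ α = ∈-filter⁺ (_∉? dom α)

  freeVars⁻ : ∀ α {v} → v ∈ freeVars α → v ∈ allVars × v ∉ dom α
  freeVars⁻ α = ∈-filter⁻ (_∉? dom α) {xs = allVars}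

  module _ (α : PartialAssignment) (q : List Var) where

    constants : Var × Var
    constants = pick (freeVars α)

    falsified : Formula (Γ ⁺)
    falsified = map isFalse q ++ map embed KB

    -- Free variables that do not occur yet are forced to be true; this makes
    -- the variable count exact without affecting satisfiability.

    unused : List Var
    unused = filter (_∉? vars falsified) (freeVars α)

    padded : Formula (Γ ⁺)
    padded = map isTrue unused ++ falsified

    bindings : Bool → Bool → PartialAssignment
    bindings a b = α ++ (proj₁ constants , a) ∷ (proj₂ constants , b) ∷ []

    reduced : Bool → Bool → Formula (Γ ⁺)
    reduced a b = isFalse (proj₁ constants) ∷ isTrue (proj₂ constants) ∷
                  map (rename (substitute constants (bindings a b))) padded

    -- The witness is `τ ∘ ρ`, as evaluating a renamed formula under `τ` is evaluating the original
    -- under the composite. This works for any guess `a`, `b`, so no branch can produce a false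
    -- positive.
    reduced-sound : Unique (dom α) → ∀ a b → ∃[ τ ] (τ ⊨ reduced a b) → Consistent α q
    reduced-sound unique a b (τ , x≡ ∷ y≡ ∷ τ⊨) =
      τ ∘ ρ ,
      ⊨-embed⁻ KB (All.++⁻ʳ (map isFalse q) models) ,
      substitute-agrees {τ = τ} α _ unique x≡false y≡ ,
      All.map (λ {v} → ⊨-isFalse⁻ {Γ} (τ ∘ ρ) v) (All.map⁻ (All.++⁻ˡ (map isFalse q) models))
      where
      x≡false = ⊨-isFalse⁻ {Γ} τ (proj₁ constants) x≡
      ρ = substitute constants (bindings a b)
      models : (τ ∘ ρ) ⊨ falsified
      models = All.++⁻ʳ (map isTrue unused) (⊨-rename⁻ τ⊨)

    -- `σ₁` is the given model with the padding variables set to true, and `τ` is `σ₁` with the two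
    -- constant names overwritten. The branch is read off from `σ₁` rather than `σ`, since `x` or
    -- `y` may itself be a padding variable.
    reduced-complete : Consistent α q → ∃[ a ] ∃[ b ] ∃[ τ ] (τ ⊨ reduced a b)
    reduced-complete (σ , σ⊨KB , σ-α , σ-q) =
      σ₁ x , σ₁ y , τ , ⊨-isFalse {Γ} τ x τx ∷ τy ∷ ⊨-rename
        (⊨-cong (λ {v} _ → sym (substitute-model {τ = τ} τx τy σ₁-agrees v (outside v))) σ₁⊨)
      where
      x = proj₁ constants
      y = proj₂ constants
      σ₁ τ : Assignment
      σ₁ v = ifᵇ does (v ∈? unused) then true else σ v
      τ v = ifᵇ does (v ≟ⱽ x) then false else (ifᵇ does (v ≟ⱽ y) then true else σ₁ v)
      τx : τ x ≡ false
      τx rewrite dec-true (x ≟ⱽ x) refl = refl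
      τy : τ y ≡ true
      τy rewrite dec-false (y ≟ⱽ x) (≢-sym (pick-distinct (picked (freeVars α))))
               | dec-true (y ≟ⱽ y) refl = refl
      unchanged : ∀ {v} → v ∉ unused → σ v ≡ σ₁ v
      unchanged {v} v∉ rewrite dec-false (v ∈? unused) v∉ = refl
      unused⁻ : ∀ {v} → v ∈ unused → v ∈ freeVars α × v ∉ vars falsified
      unused⁻ = ∈-filter⁻ (_∉? vars falsified) {xs = freeVars α}
      σ₁-α : Agrees σ₁ α
      σ₁-α = All.tabulate λ v∈α → trans
        (sym (unchanged λ v∈ → proj₂ (freeVars⁻ α (proj₁ (unused⁻ v∈))) (∈-map⁺ proj₁ v∈α)))
        (All.lookup σ-α v∈α)
      σ₁-agrees : Agrees σ₁ (bindings (σ₁ x) (σ₁ y))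
      σ₁-agrees = All.++⁺ σ₁-α (refl ∷ refl ∷ [])
      outside : ∀ v → v ∉ dom (bindings (σ₁ x) (σ₁ y)) → τ v ≡ σ₁ v
      outside v v∉
        rewrite dec-false (v ≟ⱽ x) (λ { refl → v∉ (∈-map⁺ proj₁ (∈-++⁺ʳ α (here refl))) })
              | dec-false (v ≟ⱽ y) (λ { refl → v∉ (∈-map⁺ proj₁ (∈-++⁺ʳ α (there (here refl)))) })
        = refl
      σ₁⊨ : σ₁ ⊨ padded
      σ₁⊨ = All.++⁺
        (All.map⁺ (All.tabulate λ {v} v∈ →
          cong (ifᵇ_then true else σ v) (dec-true (v ∈? unused) v∈)))
        (⊨-cong (λ v∈ → unchanged λ v∈unused → proj₂ (unused⁻ v∈unused) v∈)
          (All.++⁺ (All.map⁺ (All.map (λ {v} → ⊨-isFalse {Γ} σ v) σ-q)) (⊨-embed KB σ⊨KB)))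

    vars-falsified : vars falsified ≡ q ++ vars KB
    vars-falsified = trans (vars-++ (map isFalse q) (map embed KB))
      (cong₂ _++_ (vars-isFalse q) (vars-embed KB))

    vars-padded : vars padded ≡ unused ++ vars falsified
    vars-padded = trans (vars-++ (map isTrue unused) falsified)
      (cong (_++ vars falsified) (vars-isTrue unused))

    module _ (q⊆M : q ⊆ M) (a b : Bool) where

      private
        x = proj₁ constants
        y = proj₂ constants
        ρ = substitute constants (bindings a b)

      padded-⊆ : vars padded ⊆ allVars
      padded-⊆ v∈ with ∈-++⁻ unused (subst (_ ∈_) vars-padded v∈)
      ... | inj₁ v∈unused = proj₁ (freeVars⁻ α
              (proj₁ (∈-filter⁻ (_∉? vars falsified) {xs = freeVars α} v∈unused)))
      ... | inj₂ v∈rest with ∈-++⁻ q (subst (_ ∈_) vars-falsified v∈rest)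
      ...   | inj₁ v∈q  = ∈-++⁺ʳ (vars KB) (∈-++⁺ʳ H (q⊆M v∈q))
      ...   | inj₂ v∈KB = ∈-++⁺ˡ v∈KB

      free-⊆-padded : freeVars α ⊆ vars padded
      free-⊆-padded {v} v∈ = subst (v ∈_) (sym vars-padded) (go (v ∈? vars falsified))
        where
        go : Dec (v ∈ vars falsified) → v ∈ unused ++ vars falsified
        go (yes v∈φ) = ∈-++⁺ʳ unused v∈φ
        go (no  v∉φ) = ∈-++⁺ˡ (∈-filter⁺ (_∉? vars falsified) v∈ v∉φ)

      vars-reduced⁻ : ∀ {v} → v ∈ vars (reduced a b) → v ≡ x ⊎ v ≡ y ⊎ v ∈ freeVars α
      vars-reduced⁻ (here v≡x)          = inj₁ v≡x
      vars-reduced⁻ (there (here v≡y))  = inj₂ (inj₁ v≡y)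
      vars-reduced⁻ (there (there v∈))
        with ∈-map⁻ ρ (subst (_ ∈_) (vars-rename ρ padded) v∈)
      ... | w , w∈ , refl with w ∈? dom (bindings a b)
      ...   | yes w∈β = [ inj₁ , inj₂ ∘ inj₁ ]′ (substitute-∈ (bindings a b) w∈β)
      ...   | no  w∉β = inj₂ (inj₂ (subst (_∈ freeVars α) (sym (substitute-∉ (bindings a b) w∉β))
                (freeVars⁺ α (padded-⊆ w∈) λ w∈α → w∉β (dom-⊆ w∈α))))
        where
        dom-⊆ : dom α ⊆ dom (bindings a b)
        dom-⊆ v∈α = subst (_ ∈_) (sym (List.map-++ proj₁ α _)) (∈-++⁺ˡ v∈α)

      -- By the padding, every free variable occurs before the substitution, which leaves it alone
      -- unless it is `x` or `y`; those two reappear in the leading unit constraints.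
      vars-reduced⁺ : freeVars α ⊆ vars (reduced a b)
      vars-reduced⁺ {v} v∈ with v ∈? dom (bindings a b)
      ... | no v∉β = there (there (subst (v ∈_) (sym (vars-rename ρ padded))
              (subst (_∈ map ρ (vars padded)) (substitute-∉ (bindings a b) v∉β)
                (∈-map⁺ ρ (free-⊆-padded v∈)))))
      ... | yes v∈β with ∈-++⁻ (dom α) (subst (v ∈_) (List.map-++ proj₁ α _) v∈β)
      ...   | inj₁ v∈α                 = ⊥-elim (proj₂ (freeVars⁻ α v∈) v∈α)
      ...   | inj₂ (here refl)         = here refl
      ...   | inj₂ (there (here refl)) = there (here refl)

      -- When `x` and `y` are free themselves, the occurring variables are exactly the free ones,
      -- and these are all variables of the instance minus the distinct ones bound by `α`.
      card-reduced : Unique (dom α) → dom α ⊆ H →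
        card (vars (reduced a b)) ≡ n ∸ length α ⊎ card (vars (reduced a b)) ≤ 3
      card-reduced unique α⊆H = go refl (picked (freeVars α))
        where
        go : ∀ {xy} → constants ≡ xy → Picked (freeVars α) xy →
             card (vars (reduced a b)) ≡ n ∸ length α ⊎ card (vars (reduced a b)) ≤ 3
        go eq (two-free {x′} {y′} x∈ y∈ _) = inj₁ (trans
          (card-∖ unique (∈-++⁺ʳ (vars KB) ∘ ∈-++⁺ˡ ∘ α⊆H)
            (λ v∈ → proj₁ (freeVars⁻ α (isFree v∈)))
            (λ v∈ → proj₂ (freeVars⁻ α (isFree v∈)))
            cover)
          (cong (n ∸_) (List.length-map proj₁ α)))
          where
          isFree : vars (reduced a b) ⊆ freeVars α
          isFree v∈ with vars-reduced⁻ v∈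
          ... | inj₁ refl        = subst (_∈ freeVars α) (sym (cong proj₁ eq)) x∈
          ... | inj₂ (inj₁ refl) = subst (_∈ freeVars α) (sym (cong proj₂ eq)) y∈
          ... | inj₂ (inj₂ v∈F)  = v∈F
          cover : ∀ {v} → v ∈ allVars → v ∈ dom α ⊎ v ∈ vars (reduced a b)
          cover {v} v∈ with v ∈? dom α
          ... | yes v∈α = inj₁ v∈α
          ... | no  v∉α = inj₂ (vars-reduced⁺ (freeVars⁺ α v∈ v∉α))
        -- The possible variables are the two fallback names and the only free variable; if none is
        -- free, the third entry is a harmless default.
        go eq (one-free same) = inj₂ (card-⊆ {ys = x ∷ y ∷ firstOr[] (freeVars α) ∷ []} λ v∈ →
          [ here , [ there ∘ here , there ∘ there ∘ here ∘ same ]′ ]′ (vars-reduced⁻ v∈))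

-- Programs computing the reduced formulas

encodeBinding : Var × Bool → Tree
encodeBinding (v , b) = node (encodeVar v) (encodeBool b)

encodeVars : List Var → Tree
encodeVars = encodeList encodeVar

encodePartial : PartialAssignment → Tree
encodePartial = encodeList encodeBinding

encodePair : Var × Var → Tree
encodePair (x , y) = node (encodeVar x) (encodeVar y)

notMemberᶠ removeᶠ othersᶠ pickᶠ domᶠ : PolyFn
notMemberᶠ = ⟨ tlᶠ , hdᶠ ⟩ ⨾ᶠ memberᶠ ⨾ᶠ notᶠ
removeᶠ    = filterᶠ notMemberᶠ
othersᶠ    = ⟨ hdᶠ , idᶠ ⟩ ⨾ᶠ filterᶠ (eqᶠ ⨾ᶠ notᶠ)
pickᶠ      = ifᶠ othersᶠ then ⟨ hdᶠ , othersᶠ ⨾ᶠ hdᶠ ⟩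
             else constᶠ (encodePair ([] , true ∷ []))
domᶠ       = ⟨ nilᶠ , idᶠ ⟩ ⨾ᶠ mapᶠ (tlᶠ ⨾ᶠ hdᶠ)

⟦removeᶠ⟧ : ∀ ws vs →
  ⟦ removeᶠ ⟧ (node (encodeVars ws) (encodeVars vs)) ≡ encodeVars (filter (_∉? ws) vs)
⟦removeᶠ⟧ ws vs = ⟦filterᶠ⟧ (_∉? ws) notMemberᶠ
  (λ v → trans (cong ⟦ notᶠ ⟧ (⟦memberᶠ⟧ v ws)) (⟦notᶠ⟧ (does (v ∈? ws)))) vs

-- The head of the empty list is `leaf`, which also encodes the variable `[]`; hence the default
-- value chosen in `firstOr[]`.
hdᵀ-encodeVars : ∀ vs → hdᵀ (encodeVars vs) ≡ encodeVar (firstOr[] vs)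
hdᵀ-encodeVars []      = refl
hdᵀ-encodeVars (_ ∷ _) = refl

⟦othersᶠ⟧ : ∀ vs → ⟦ othersᶠ ⟧ (encodeVars vs) ≡ encodeVars (others vs)
⟦othersᶠ⟧ vs = trans
  (cong (λ t → ⟦ filterᶠ (eqᶠ ⨾ᶠ notᶠ) ⟧ (node t (encodeVars vs))) (hdᵀ-encodeVars vs))
  (⟦filterᶠ⟧ (λ v → ¬? (firstOr[] vs ≟ⱽ v)) (eqᶠ ⨾ᶠ notᶠ)
    (λ v → trans (cong ⟦ notᶠ ⟧ (⟦eqᶠ⟧ (firstOr[] vs) v)) (⟦notᶠ⟧ (does (firstOr[] vs ≟ⱽ v)))) vs)

⟦pickᶠ⟧ : ∀ vs → ⟦ pickᶠ ⟧ (encodeVars vs) ≡ encodePair (pick vs)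
⟦pickᶠ⟧ vs rewrite ⟦othersᶠ⟧ vs | hdᵀ-encodeVars vs with others vs
... | []    = refl
... | _ ∷ _ = refl

⟦domᶠ⟧ : ∀ α → ⟦ domᶠ ⟧ (encodePartial α) ≡ encodeVars (dom α)
⟦domᶠ⟧ = ⟦mapᶠ⟧ (tlᶠ ⨾ᶠ hdᶠ) (λ _ → refl)

-- Lookup by filtering: the first binding that survives is the one at which `substitute` stops, and
-- its tail holds the Boolean that selects the constant.
matchesᶠ substituteᶠ renameᶠ : PolyFn
matchesᶠ = ⟨ tlᶠ , hdᶠ ⨾ᶠ tlᶠ ⟩ ⨾ᶠ filterᶠ (⟨ hdᶠ , tlᶠ ⨾ᶠ hdᶠ ⟩ ⨾ᶠ eqᶠ)
substituteᶠ = ifᶠ matchesᶠ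
  then (ifᶠ matchesᶠ ⨾ᶠ hdᶠ ⨾ᶠ tlᶠ then (hdᶠ ⨾ᶠ hdᶠ ⨾ᶠ tlᶠ) else (hdᶠ ⨾ᶠ hdᶠ ⨾ᶠ hdᶠ))
  else tlᶠ
renameᶠ = ⟨ tlᶠ ⨾ᶠ hdᶠ , ⟨ hdᶠ , tlᶠ ⨾ᶠ tlᶠ ⟩ ⨾ᶠ mapᶠ substituteᶠ ⟩

⟦substituteᶠ⟧ : ∀ xy β v →
  ⟦ substituteᶠ ⟧ (node (node (encodePair xy) (encodePartial β)) (encodeVar v))
  ≡ encodeVar (substitute xy β v)
⟦substituteᶠ⟧ xy β v
  rewrite ⟦filterᶠ⟧ {enc = encodeBinding} (λ (w , _) → v ≟ⱽ w)
            (⟨ hdᶠ , tlᶠ ⨾ᶠ hdᶠ ⟩ ⨾ᶠ eqᶠ) (λ (w , _) → ⟦eqᶠ⟧ v w) β = go β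
  where
  matches : PartialAssignment → Tree
  matches β = encodePartial (filter (λ (w , _) → v ≟ⱽ w) β)
  go : ∀ β → ifᵀ (matches β)
                 (ifᵀ (tlᵀ (hdᵀ (matches β))) (tlᵀ (encodePair xy)) (hdᵀ (encodePair xy)))
                 (encodeVar v)
             ≡ encodeVar (substitute xy β v)
  go []            = refl
  go ((w , b) ∷ β) with does (v ≟ⱽ w)
  go ((w , true) ∷ β)  | true  = refl
  go ((w , false) ∷ β) | true  = refl
  go ((w , b) ∷ β)     | false = go β

module _ (rep : Representation) where

  -- `rep` is arbitrary and cannot be assumed computable. Only the descriptions of `⊥ᴿ` and `⊤ᴿ` are
  -- ever created, and these are two fixed trees; all others are copied from the input.
  varsᶠ isFalseᶠ isTrueᶠ : PolyFn
  varsᶠ    = ⟨ nilᶠ , idᶠ ⟩ ⨾ᶠ concatMapᶠ (tlᶠ ⨾ᶠ tlᶠ)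
  isFalseᶠ = ⟨ constᶠ (rep ⊥ᴿ) , ⟨ idᶠ , nilᶠ ⟩ ⟩
  isTrueᶠ  = ⟨ constᶠ (rep ⊤ᴿ) , ⟨ idᶠ , nilᶠ ⟩ ⟩

  module _ {Γ : ConstraintLanguage} where

    ⟦varsᶠ⟧ : (φ : Formula Γ) → ⟦ varsᶠ ⟧ (encodeFormula rep φ) ≡ encodeVars (vars φ)
    ⟦varsᶠ⟧ = ⟦concatMapᶠ⟧ (tlᶠ ⨾ᶠ tlᶠ) (λ _ → refl)

    ⟦isFalseᶠ⟧ : ∀ v → ⟦ isFalseᶠ ⟧ (encodeVar v) ≡ encodeConstraint rep {Γ ⁺} (isFalse v)
    ⟦isFalseᶠ⟧ v = cong (λ t → node t _) (⟦constᶠ⟧ (rep ⊥ᴿ))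

    ⟦isTrueᶠ⟧ : ∀ v → ⟦ isTrueᶠ ⟧ (encodeVar v) ≡ encodeConstraint rep {Γ ⁺} (isTrue v)
    ⟦isTrueᶠ⟧ v = cong (λ t → node t _) (⟦constᶠ⟧ (rep ⊤ᴿ))

    encode-embed : (φ : Formula Γ) →
      encodeFormula rep {Γ ⁺} (map embed φ) ≡ encodeFormula rep φ
    encode-embed []      = refl
    encode-embed (C ∷ φ) = cong (node _) (encode-embed φ)

    ⟦renameᶠ⟧ : ∀ xy β C →
      ⟦ renameᶠ ⟧ (node (node (encodePair xy) (encodePartial β)) (encodeConstraint rep {Γ ⁺} C))
      ≡ encodeConstraint rep {Γ ⁺} (rename (substitute xy β) C)
    ⟦renameᶠ⟧ xy β C = cong (node _) (trans
      (⟦mapᶠ⟧ substituteᶠ (⟦substituteᶠ⟧ xy β) (Vec.toList (Constraint.args C)))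
      (cong encodeVars (sym (Vec.toList-map (substitute xy β) (Constraint.args C)))))

  -- A query is laid out as node I (node α q).

  formulaᶠ partialᶠ allVarsᶠ freeVarsᶠ constantsᶠ falsifiedᶠ unusedᶠ paddedᶠ : PolyFn
  formulaᶠ   = hdᶠ ⨾ᶠ hdᶠ
  partialᶠ   = tlᶠ ⨾ᶠ hdᶠ
  allVarsᶠ   = ⟨ formulaᶠ ⨾ᶠ varsᶠ , hdᶠ ⨾ᶠ tlᶠ ⨾ᶠ appendᶠ ⟩ ⨾ᶠ appendᶠ
  freeVarsᶠ  = ⟨ partialᶠ ⨾ᶠ domᶠ , allVarsᶠ ⟩ ⨾ᶠ removeᶠ
  constantsᶠ = freeVarsᶠ ⨾ᶠ pickᶠ
  falsifiedᶠ = ⟨ ⟨ nilᶠ , tlᶠ ⨾ᶠ tlᶠ ⟩ ⨾ᶠ mapᶠ (tlᶠ ⨾ᶠ isFalseᶠ) , formulaᶠ ⟩ ⨾ᶠ appendᶠ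
  unusedᶠ    = ⟨ falsifiedᶠ ⨾ᶠ varsᶠ , freeVarsᶠ ⟩ ⨾ᶠ removeᶠ
  paddedᶠ    = ⟨ ⟨ nilᶠ , unusedᶠ ⟩ ⨾ᶠ mapᶠ (tlᶠ ⨾ᶠ isTrueᶠ) , falsifiedᶠ ⟩ ⨾ᶠ appendᶠ

  bindingsᶠ : Bool → Bool → PolyFn
  bindingsᶠ a b = ⟨ partialᶠ
    , ⟨ ⟨ constantsᶠ ⨾ᶠ hdᶠ , constᶠ (encodeBool a) ⟩
      , ⟨ ⟨ constantsᶠ ⨾ᶠ tlᶠ , constᶠ (encodeBool b) ⟩ , nilᶠ ⟩ ⟩ ⟩ ⨾ᶠ appendᶠ

  opaque
    reducedᶠ : Bool → Bool → PolyFn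
    reducedᶠ a b = ⟨ constantsᶠ ⨾ᶠ hdᶠ ⨾ᶠ isFalseᶠ , ⟨ constantsᶠ ⨾ᶠ tlᶠ ⨾ᶠ isTrueᶠ
      , ⟨ ⟨ constantsᶠ , bindingsᶠ a b ⟩ , paddedᶠ ⟩ ⨾ᶠ mapᶠ renameᶠ ⟩ ⟩

  module _ {Γ : ConstraintLanguage} (I : AbductionInstance Γ)
           (α : PartialAssignment) (q : List Var) where
    open AbductionInstance I

    encodeQuery : Tree
    encodeQuery = node (encodeAbduction rep I) (node (encodePartial α) (encodeVars q))

    private
      pair : PolyFn → Tree → Tree → Tree
      pair f s t = ⟦ f ⟧ (node s t)

    ⟦freeVarsᶠ⟧ : ⟦ freeVarsᶠ ⟧ encodeQuery ≡ encodeVars (freeVars I α)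
    ⟦freeVarsᶠ⟧ = trans (cong₂ (pair removeᶠ) (⟦domᶠ⟧ α)
      (trans (cong₂ (pair appendᶠ) (⟦varsᶠ⟧ KB) (⟦appendᶠ⟧ encodeVar H M))
             (⟦appendᶠ⟧ encodeVar (vars KB) (H ++ M))))
      (⟦removeᶠ⟧ (dom α) (allVars I))

    ⟦constantsᶠ⟧ : ⟦ constantsᶠ ⟧ encodeQuery ≡ encodePair (constants I α q)
    ⟦constantsᶠ⟧ = trans (cong ⟦ pickᶠ ⟧ ⟦freeVarsᶠ⟧) (⟦pickᶠ⟧ (freeVars I α))

    ⟦falsifiedᶠ⟧ : ⟦ falsifiedᶠ ⟧ encodeQuery ≡ encodeFormula rep (falsified I α q)
    ⟦falsifiedᶠ⟧ = trans
      (cong₂ (pair appendᶠ) (⟦mapᶠ⟧ (tlᶠ ⨾ᶠ isFalseᶠ) (⟦isFalseᶠ⟧ {Γ}) q) (sym (encode-embed KB)))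
      (⟦appendᶠ⟧ (encodeConstraint rep) (map isFalse q) (map embed KB))

    ⟦unusedᶠ⟧ : ⟦ unusedᶠ ⟧ encodeQuery ≡ encodeVars (unused I α q)
    ⟦unusedᶠ⟧ = trans
      (cong₂ (pair removeᶠ) (trans (cong ⟦ varsᶠ ⟧ ⟦falsifiedᶠ⟧) (⟦varsᶠ⟧ (falsified I α q)))
                            ⟦freeVarsᶠ⟧)
      (⟦removeᶠ⟧ (vars (falsified I α q)) (freeVars I α))

    ⟦paddedᶠ⟧ : ⟦ paddedᶠ ⟧ encodeQuery ≡ encodeFormula rep (padded I α q)
    ⟦paddedᶠ⟧ = trans
      (cong₂ (pair appendᶠ)
        (trans (cong (pair (mapᶠ (tlᶠ ⨾ᶠ isTrueᶠ)) leaf) ⟦unusedᶠ⟧)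
               (⟦mapᶠ⟧ (tlᶠ ⨾ᶠ isTrueᶠ) (⟦isTrueᶠ⟧ {Γ}) (unused I α q)))
        ⟦falsifiedᶠ⟧)
      (⟦appendᶠ⟧ (encodeConstraint rep) (map isTrue (unused I α q)) (falsified I α q))

    ⟦bindingsᶠ⟧ : ∀ a b → ⟦ bindingsᶠ a b ⟧ encodeQuery ≡ encodePartial (bindings I α q a b)
    ⟦bindingsᶠ⟧ a b = trans
      (cong (pair appendᶠ (encodePartial α))
        (cong₂ node
          (cong₂ node (cong hdᵀ ⟦constantsᶠ⟧) (⟦constᶠ⟧ (encodeBool a)))
          (cong (λ t → node t leaf)
            (cong₂ node (cong tlᵀ ⟦constantsᶠ⟧) (⟦constᶠ⟧ (encodeBool b))))))
      (⟦appendᶠ⟧ encodeBinding α _)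

    opaque
      unfolding reducedᶠ

      ⟦reducedᶠ⟧ : ∀ a b → ⟦ reducedᶠ a b ⟧ encodeQuery ≡ encodeFormula rep (reduced I α q a b)
      ⟦reducedᶠ⟧ a b = cong₂ node
        (trans (cong (⟦ isFalseᶠ ⟧ ∘ hdᵀ) ⟦constantsᶠ⟧) (⟦isFalseᶠ⟧ {Γ} _))
        (cong₂ node
          (trans (cong (⟦ isTrueᶠ ⟧ ∘ tlᵀ) ⟦constantsᶠ⟧) (⟦isTrueᶠ⟧ {Γ} _))
          (trans
            (cong₂ (pair (mapᶠ renameᶠ)) (cong₂ node ⟦constantsᶠ⟧ (⟦bindingsᶠ⟧ a b)) ⟦paddedᶠ⟧)
            (⟦mapᶠ⟧ renameᶠ (⟦renameᶠ⟧ (constants I α q) (bindings I α q a b))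
                   (padded I α q))))

-- Answering a query with the given solver

time-positive : ∀ {p x y t} → p ∶ x ⇓ y [ t ] → 1 ≤ t
time-positive id⇓                 = s≤s z≤n
time-positive nil⇓                = s≤s z≤n
time-positive hd-leaf⇓            = s≤s z≤n
time-positive hd-node⇓            = s≤s z≤n
time-positive tl-leaf⇓            = s≤s z≤n
time-positive tl-node⇓            = s≤s z≤n
time-positive (cons⇓ _ _)         = s≤s z≤n
time-positive (⨾⇓ _ _)            = s≤s z≤n
time-positive (if-true⇓ _ _)      = s≤s z≤n
time-positive (if-false⇓ _ _)     = s≤s z≤n
time-positive (while-stop⇓ _)     = s≤s z≤n
time-positive (while-step⇓ _ _ _) = s≤s z≤n

orᴾ : Program → Program → Program
orᴾ p q = if p then prog trueᶠ else q

or⇓ : ∀ {p q x s t} a b → p ∶ x ⇓ encodeBool a [ s ] → q ∶ x ⇓ encodeBool b [ t ] →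
      ∃[ u ] (orᴾ p q ∶ x ⇓ encodeBool (a ∨ b) [ u ] × u ≤ 4 + s + t)
or⇓ {x = x} {s} {t} false b pa qb = _ , if-false⇓ pa qb , s≤s (+-monoˡ-≤ t (m≤n+m s 3))
or⇓ {x = x} {s} {t} true  b pa qb = _ , if-true⇓ pa (runs trueᶠ x) ,
  ≤-trans (≤-reflexive (p s)) (m≤m+n (4 + s) t)
  where
  p : ∀ s → 1 + s + 3 ≡ 4 + s
  p = solve-∀

∨-true⁻ : ∀ {a b} → a ∨ b ≡ true → a ≡ true ⊎ b ≡ true
∨-true⁻ {false} b≡ = inj₂ b≡
∨-true⁻ {true}  _  = inj₁ refl

∨-true⁺ : ∀ {a b} → a ≡ true ⊎ b ≡ true → a ∨ b ≡ true
∨-true⁺         (inj₁ refl) = refl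
∨-true⁺ {false} (inj₂ refl) = refl
∨-true⁺ {true}  (inj₂ refl) = refl

-- The names are unary numerals, that is, strings of `true` of lengths 0 to `m - 1`.
distinctVars : ℕ → List Var
distinctVars zero    = []
distinctVars (suc m) = [] ∷ map (true ∷_) (distinctVars m)

distinctVars-unique : ∀ m → Unique (distinctVars m)
distinctVars-unique zero    = []
distinctVars-unique (suc m) =
  All.map⁺ (All.universal (λ _ ()) (distinctVars m)) ∷
  Unique.map⁺ List.∷-injectiveʳ (distinctVars-unique m)

length-distinctVars : ∀ m → length (distinctVars m) ≡ m
length-distinctVars zero    = refl
length-distinctVars (suc m) =
  cong suc (trans (List.length-map (true ∷_) (distinctVars m)) (length-distinctVars m))

-- The field `small` makes every query polynomial in the size of the instance, so that a single
-- polynomial serves all candidates.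
record Admissible (H : List Var) (α : PartialAssignment) : Set where
  field
    unique     : Unique (dom α)
    hypotheses : dom α ⊆ H
    small      : size (encodePartial α) ≤ 1 + 4 * size (encodeVars H)

module _ (Γ : ConstraintLanguage) (rep : Representation) (f : ℕ → ℕ)
         (solvable : SolvableInTime (SAT rep (Γ ⁺)) (λ φ → f (card (vars φ)))) where

  private
    solver = proj₁ solvable
    c = proj₁ (proj₂ solvable)
    k = proj₁ (proj₂ (proj₂ solvable))
    solve = proj₂ (proj₂ (proj₂ solvable))

  -- Formulas with exactly m variables exist for every m, so a running time
  -- bound cannot vanish anywhere.

  f-positive : ∀ m → 1 ≤ f m
  f-positive m with solve (map isTrue (distinctVars m))
  ... | _ , t , run , t≤ , _ = go (f m) (subst (λ l → t ≤ overhead * f l) count t≤)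
    where
    φ : Formula (Γ ⁺)
    φ = map isTrue (distinctVars m)
    overhead = c * size (encodeFormula rep φ) ^ k
    count : card (vars φ) ≡ m
    count = trans (cong card (vars-isTrue (distinctVars m)))
      (trans (card-Unique (distinctVars-unique m)) (length-distinctVars m))
    go : ∀ l → t ≤ overhead * l → 1 ≤ l
    go zero    t≤0 = ⊥-elim (1+n≰n (≤-trans (time-positive run)
                       (≤-trans t≤0 (≤-reflexive (*-zeroʳ overhead)))))
    go (suc l) _   = s≤s z≤n

  -- The sum dominates `f` at all arguments up to 3. The leading 1 makes the factor at least one, so
  -- that it also serves when the variable count is exact.
  smallBound : ℕ
  smallBound = 1 + (f 0 + (f 1 + (f 2 + f 3)))

  f-small : ∀ {l} → l ≤ 3 → f l ≤ smallBound
  f-small {0} _ = m≤n⇒m≤1+n (m≤m+n (f 0) _)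
  f-small {1} _ = m≤n⇒m≤1+n (m≤n⇒m≤o+n (f 0) (m≤m+n (f 1) _))
  f-small {2} _ = m≤n⇒m≤1+n (m≤n⇒m≤o+n (f 0) (m≤n⇒m≤o+n (f 1) (m≤m+n (f 2) _)))
  f-small {3} _ = m≤n⇒m≤1+n (m≤n⇒m≤o+n (f 0) (m≤n⇒m≤o+n (f 1) (m≤n+m (f 3) (f 2))))
  f-small {suc (suc (suc (suc _)))} (s≤s (s≤s (s≤s ())))

  f-reduced : ∀ {l m} → l ≡ m ⊎ l ≤ 3 → f l ≤ smallBound * f m
  f-reduced {m = m} (inj₁ refl) = m≤m+n (f m) _
  f-reduced {m = m} (inj₂ l≤3)  = ≤-trans (f-small l≤3)
    (≤-trans (≤-reflexive (sym (*-identityʳ smallBound))) (*-monoʳ-≤ smallBound (f-positive m)))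

  branch : Bool → Bool → Program
  branch a b = prog (reducedᶠ rep a b) ⨾ solver

  opaque
    consistent : Program
    consistent = orᴾ (orᴾ (branch false false) (branch false true))
                     (orᴾ (branch true false) (branch true true))

  branchBound : Bool → Bool → Tree → ℕ
  branchBound a b x = 1 + time (reducedᶠ rep a b) x
                    + c * size (⟦ reducedᶠ rep a b ⟧ x) ^ k * smallBound

  opaque
    consistentBound : Tree → ℕ
    -- Three disjunctions with at most 4 extra steps each.
    consistentBound x = 12 + (branchBound false false x + branchBound false true x
                            + (branchBound true false x + branchBound true true x))

    consistentBound≼ : consistentBound ≼ size
    consistentBound≼ = ≼-+ (≼-const 12)
      (≼-+ (≼-+ (b≼ false false) (b≼ false true)) (≼-+ (b≼ true false) (b≼ true true)))
      where
      b≼ : ∀ a b → branchBound a b ≼ size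
      b≼ a b = ≼-+ (≼-+ (≼-const 1) (time≼ (reducedᶠ rep a b)))
        (≼-* (≼-* (≼-const c) (≼-^ (size≼ (reducedᶠ rep a b)) k)) (≼-const smallBound))

  module _ (I : AbductionInstance Γ) where
    open AbductionInstance I

    module _ {α : PartialAssignment} (admissible : Admissible H α) where
      open Admissible admissible

      branch⇓ : ∀ {q} → q ⊆ M → ∀ a b → ∃[ r ] ∃[ t ]
        (branch a b ∶ encodeQuery rep I α q ⇓ encodeBool r [ t ]
        × t ≤ branchBound a b (encodeQuery rep I α q) * f (n ∸ length α)
        × (r ≡ true ⇔ (∃[ τ ] (τ ⊨ reduced I α q a b))))
      branch⇓ {q} q⊆M a b with solve (reduced I α q a b)
      ... | r , t , run , t≤ , r⇔ = r , _ ,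
        ⨾⇓ (runs (reducedᶠ rep a b) Q)
           (subst (λ x → solver ∶ x ⇓ encodeBool r [ t ]) (sym Q≡) run) ,
        bound , r⇔
        where
        Q = encodeQuery rep I α q
        Q≡ : ⟦ reducedᶠ rep a b ⟧ Q ≡ encodeFormula rep (reduced I α q a b)
        Q≡ = ⟦reducedᶠ⟧ rep I α q a b
        φ = f (n ∸ length α)
        s = size (⟦ reducedᶠ rep a b ⟧ Q)
        open ≤-Reasoning
        t≤′ : t ≤ c * s ^ k * smallBound * φ
        t≤′ = begin
          t ≤⟨ t≤ ⟩
          c * size (encodeFormula rep (reduced I α q a b)) ^ k * f (card (vars (reduced I α q a b)))
            ≡⟨ cong (λ x → c * size x ^ k * f (card (vars (reduced I α q a b)))) Q≡ ⟨
          c * s ^ k * f (card (vars (reduced I α q a b)))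
            ≤⟨ *-monoʳ-≤ (c * s ^ k)
                 (f-reduced (card-reduced I α q q⊆M a b unique hypotheses)) ⟩
          c * s ^ k * (smallBound * φ) ≡⟨ *-assoc (c * s ^ k) smallBound φ ⟨
          c * s ^ k * smallBound * φ   ∎
        d = 1 + time (reducedᶠ rep a b) Q
        bound : d + t ≤ branchBound a b Q * φ
        bound = begin
          d + t                                ≡⟨ cong (_+ t) (*-identityʳ d) ⟨
          -- The cost of building the formula is not proportional to `φ`; it is absorbed because `φ`
          -- is at least one.
          d * 1 + t
            ≤⟨ +-mono-≤ (*-monoʳ-≤ d (f-positive (n ∸ length α))) t≤′ ⟩
          d * φ + c * s ^ k * smallBound * φ   ≡⟨ *-distribʳ-+ φ d _ ⟨
          branchBound a b Q * φ                ∎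

      opaque
        unfolding consistent consistentBound

        consistent⇓ : ∀ {q} → q ⊆ M → ∃[ r ] ∃[ t ]
          (consistent ∶ encodeQuery rep I α q ⇓ encodeBool r [ t ]
          × t ≤ consistentBound (encodeQuery rep I α q) * f (n ∸ length α)
          × (r ≡ true ⇔ Consistent I α q))
        consistent⇓ {q} q⊆M =
          let Q = encodeQuery rep I α q
              φ = f (n ∸ length α)
              r₁ , t₁ , run₁ , t₁≤ , r₁⇔ = branch⇓ q⊆M false false
              r₂ , t₂ , run₂ , t₂≤ , r₂⇔ = branch⇓ q⊆M false true
              r₃ , t₃ , run₃ , t₃≤ , r₃⇔ = branch⇓ q⊆M true false
              r₄ , t₄ , run₄ , t₄≤ , r₄⇔ = branch⇓ q⊆M true true
              u₁ , run₅ , u₁≤ = or⇓ r₁ r₂ run₁ run₂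
              u₂ , run₆ , u₂≤ = or⇓ r₃ r₄ run₃ run₄
              u  , run  , u≤  = or⇓ (r₁ ∨ r₂) (r₃ ∨ r₄) run₅ run₆
              sound : ∀ a b {r} → (r ≡ true ⇔ (∃[ τ ] (τ ⊨ reduced I α q a b))) →
                      r ≡ true → Consistent I α q
              sound a b = λ r⇔ r≡ → reduced-sound I α q unique a b (to r⇔ r≡)
              complete : Consistent I α q → (r₁ ∨ r₂) ∨ (r₃ ∨ r₄) ≡ true
              complete = λ con → case {P = λ a b → ∃[ τ ] (τ ⊨ reduced I α q a b)}
                (reduced-complete I α q con)
                (from r₁⇔) (from r₂⇔) (from r₃⇔) (from r₄⇔)
          in (r₁ ∨ r₂) ∨ (r₃ ∨ r₄) , u , run ,
             ≤-trans u≤ (≤-trans (+-mono-≤ (+-monoʳ-≤ 4 (≤-trans u₁≤ (+-mono-≤ (+-monoʳ-≤ 4 t₁≤) t₂≤)))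
                                           (≤-trans u₂≤ (+-mono-≤ (+-monoʳ-≤ 4 t₃≤) t₄≤)))
                          (collect (branchBound false false Q) (branchBound false true Q)
                            (branchBound true false Q) (branchBound true true Q) φ
                            (f-positive (n ∸ length α)))) ,
             mk⇔ ([ [ sound false false r₁⇔ , sound false true r₂⇔ ]′ ∘ ∨-true⁻
                  , [ sound true false r₃⇔ , sound true true r₄⇔ ]′ ∘ ∨-true⁻ ]′ ∘ ∨-true⁻)
                 complete
          where
          case : ∀ {P : Bool → Bool → Set} {r₁ r₂ r₃ r₄} → ∃[ a ] ∃[ b ] P a b →
                 (P false false → r₁ ≡ true) → (P false true → r₂ ≡ true) →
                 (P true false → r₃ ≡ true) → (P true true → r₄ ≡ true) →
                 (r₁ ∨ r₂) ∨ (r₃ ∨ r₄) ≡ true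
          case {r₁ = r₁} (false , false , p) g₁ g₂ g₃ g₄ = ∨-true⁺ (inj₁ (∨-true⁺ (inj₁ (g₁ p))))
          case {r₁ = r₁} (false , true , p)  g₁ g₂ g₃ g₄ = ∨-true⁺ (inj₁ (∨-true⁺ {r₁} (inj₂ (g₂ p))))
          case {r₁ = r₁} {r₂} (true , false , p) g₁ g₂ g₃ g₄ =
            ∨-true⁺ {r₁ ∨ r₂} (inj₂ (∨-true⁺ (inj₁ (g₃ p))))
          case {r₁ = r₁} {r₂} {r₃} (true , true , p) g₁ g₂ g₃ g₄ =
            ∨-true⁺ {r₁ ∨ r₂} (inj₂ (∨-true⁺ {r₃} (inj₂ (g₄ p))))
          rearrange : ∀ a b c d → 4 + (4 + a + b) + (4 + c + d) ≡ 12 * 1 + (a + b + (c + d))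
          rearrange = solve-∀
          factor : ∀ a b c d φ → 12 * φ + (a * φ + b * φ + (c * φ + d * φ))
                                 ≡ (12 + (a + b + (c + d))) * φ
          factor = solve-∀
          collect : ∀ a b c d φ → 1 ≤ φ →
            4 + (4 + a * φ + b * φ) + (4 + c * φ + d * φ) ≤ (12 + (a + b + (c + d))) * φ
          collect a b c d φ 1≤φ = ≤-trans
            (≤-reflexive (rearrange (a * φ) (b * φ) (c * φ) (d * φ)))
            (≤-trans (+-monoˡ-≤ _ (*-monoʳ-≤ 12 1≤φ)) (≤-reflexive (factor a b c d φ)))

-- Testing a single candidate

size-∈ : {A : Set} (enc : A → Tree) {x : A} {xs : List A} →
         Any (x ≡_) xs → size (enc x) ≤ size (encodeList enc xs)
size-∈ enc {xs = x ∷ xs} (here refl) = size-hdᵀ (encodeList enc (x ∷ xs))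
size-∈ enc {xs = x ∷ xs} (there x∈)  =
  ≤-trans (size-∈ enc x∈) (size-tlᵀ (encodeList enc (x ∷ xs)))

firstQueryᶠ nextQueryᶠ : PolyFn
firstQueryᶠ = ⟨ hdᶠ , ⟨ tlᶠ , nilᶠ ⟩ ⟩
nextQueryᶠ  = ⟨ tlᶠ ⨾ᶠ tlᶠ ⨾ᶠ hdᶠ , ⟨ tlᶠ ⨾ᶠ tlᶠ ⨾ᶠ tlᶠ , ⟨ hdᶠ ⨾ᶠ hdᶠ , nilᶠ ⟩ ⟩ ⟩

-- The state is node ms (node ok (node I α)), with ms the manifestations
-- still to be tested.
entailsAll : Program → Program
entailsAll query = while hd loop
  cons (hd ⨾ tl)
    (cons (if prog nextQueryᶠ ⨾ query then nil else (tl ⨾ hd)) (tl ⨾ tl))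

-- The input is node I α.

checkWith : Program → Program
checkWith query = cons (hd ⨾ tl ⨾ tl) (cons (prog firstQueryᶠ ⨾ query) id) ⨾
                  entailsAll query ⨾ tl ⨾ hd

module _ {query : Program} {encI encα : Tree} {M : List Var} {P : Var → Set} {W : ℕ}
         (query⇓ : ∀ {m} → m ∈ M → ∃[ r ] ∃[ t ]
           (query ∶ node encI (node encα (encodeVars (m ∷ []))) ⇓ encodeBool r [ t ]
           × t ≤ W × (r ≡ true ⇔ P m))) where

  entailsAll⇓ : ∀ ms → ms ⊆ M → ∀ ok → ∃[ r ] ∃[ t ]
    (entailsAll query ∶ node (encodeVars ms) (node (encodeBool ok) (node encI encα))
       ⇓ node leaf (node (encodeBool r) (node encI encα)) [ t ]
    × t ≤ length ms * (33 + W) + 2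
    × (r ≡ true ⇔ (ok ≡ true × All (¬_ ∘ P) ms)))
  entailsAll⇓ [] ms⊆M ok =
    ok , 2 , while-stop⇓ hd-node⇓ , ≤-refl , mk⇔ (λ ok≡ → ok≡ , []) proj₁
  entailsAll⇓ (m ∷ ms) ms⊆M ok
    with query⇓ (ms⊆M (here refl))
  ... | r , t , run , t≤ , r⇔ with entailsAll⇓ ms (ms⊆M ∘ there) (ifᵇ r then false else ok)
  ...   | r′ , t′ , run′ , t′≤ , r′⇔ =
    r′ , _ ,
    while-step⇓ hd-node⇓
      (cons⇓ (⨾⇓ hd-node⇓ tl-node⇓)
        (cons⇓ (if⇓ (encodeBool r) (⨾⇓ (runs nextQueryᶠ state) run) nil⇓
                    (⨾⇓ tl-node⇓ hd-node⇓))
               (⨾⇓ tl-node⇓ tl-node⇓)))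
      (subst (λ b → entailsAll query ∶ node (encodeVars ms) (node b (node encI encα))
                      ⇓ node leaf (node (encodeBool r′) (node encI encα)) [ t′ ])
             (updated r) run′) ,
    -- One iteration takes 29 steps besides the query and the chosen branch of the conditional. That
    -- branch takes 1 or 3 steps and is bounded by their sum, whence 33; the final 2 is the failing
    -- loop test.
    (begin
      _ ≡⟨ cost t (ifᵀ (encodeBool r) 1 3) t′ ⟩
      29 + t + ifᵀ (encodeBool r) 1 3 + t′
        ≤⟨ +-mono-≤ (+-mono-≤ (+-monoʳ-≤ 29 t≤) (ifᵀ-≤-+ (encodeBool r) 1 3)) t′≤ ⟩
      29 + W + 4 + (length ms * (33 + W) + 2)  ≡⟨ total W (length ms * (33 + W)) ⟩
      length (m ∷ ms) * (33 + W) + 2 ∎) ,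
    mk⇔ (λ r′≡ → let ok′ , rest = to r′⇔ r′≡
                     r≢ , ok≡ = unskip r ok′
                 in ok≡ , (r≢ ∘ from r⇔) ∷ rest)
        (λ { (ok≡ , ¬p ∷ rest) → from r′⇔ (reskip r (¬p ∘ to r⇔) ok≡ , rest) })
    where
    open ≤-Reasoning
    state = node (encodeVars (m ∷ ms)) (node (encodeBool ok) (node encI encα))
    updated : ∀ r → encodeBool (ifᵇ r then false else ok)
                    ≡ ifᵀ (encodeBool r) leaf (encodeBool ok)
    updated false = refl
    updated true  = refl
    unskip : ∀ r → (ifᵇ r then false else ok) ≡ true → r ≢ true × ok ≡ true
    unskip false ok≡ = (λ ()) , ok≡
    reskip : ∀ r → r ≢ true → ok ≡ true → (ifᵇ r then false else ok) ≡ true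
    reskip false r≢ ok≡ = ok≡
    reskip true  r≢ ok≡ = ⊥-elim (r≢ refl)
    cost : ∀ t i w → 2 + (1 + 3 + (1 + (1 + (1 + 17 + t) + i) + 3)) + w ≡ 29 + t + i + w
    cost = solve-∀
    total : ∀ W l → 29 + W + 4 + (l + 2) ≡ 33 + W + l + 2
    total = solve-∀

  checkWith⇓ : ∀ {encKB encH} {P₀ : Set} → encI ≡ node encKB (node encH (encodeVars M)) →
    ∃[ r ] ∃[ t ] (query ∶ node encI (node encα leaf) ⇓ encodeBool r [ t ]
                  × t ≤ W × (r ≡ true ⇔ P₀)) →
    ∃[ r ] ∃[ t ] (checkWith query ∶ node encI encα ⇓ encodeBool r [ t ]
                  × t ≤ (length M + 1) * (33 + W)
                  × (r ≡ true ⇔ (P₀ × All (¬_ ∘ P) M)))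
  checkWith⇓ refl (r , t , run , t≤ , r⇔) with entailsAll⇓ M (λ m∈ → m∈) r
  ... | r′ , t′ , run′ , t′≤ , r′⇔ =
    r′ , _ ,
    ⨾⇓ (cons⇓ (⨾⇓ hd-node⇓ (⨾⇓ tl-node⇓ tl-node⇓))
          (cons⇓ (⨾⇓ (runs firstQueryᶠ (node encI encα)) run) id⇓))
       (⨾⇓ run′ (⨾⇓ tl-node⇓ hd-node⇓)) ,
    (begin
      _ ≡⟨ cost t t′ ⟩
      19 + t + t′                            ≤⟨ +-mono-≤ (+-monoʳ-≤ 19 t≤) t′≤ ⟩
      -- The slack of 12 rounds 19 + 2 up to 33, so that the initial consistency query costs as much
      -- as one manifestation.
      19 + W + (length M * (33 + W) + 2)     ≤⟨ m≤m+n _ 12 ⟩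
      19 + W + (length M * (33 + W) + 2) + 12 ≡⟨ total W (length M) ⟩
      (length M + 1) * (33 + W)              ∎) ,
    mk⇔ (λ r′≡ → let r≡ , none = to r′⇔ r′≡ in to r⇔ r≡ , none)
        (λ (con , none) → from r′⇔ (from r⇔ con , none))
    where
    open ≤-Reasoning
    cost : ∀ t w → 1 + (1 + 5 + (1 + (1 + 5 + t) + 1)) + (1 + w + 3) ≡ 19 + t + w
    cost = solve-∀
    total : ∀ W l → 19 + W + (l * (33 + W) + 2) + 12 ≡ (l + 1) * (33 + W)
    total = solve-∀

check-cost : ∀ b φ m → 1 ≤ φ → (m + 1) * (33 + b * φ) ≤ (33 + b) * (φ * (m + 1))
check-cost b φ m 1≤φ = begin
  (m + 1) * (33 * 1 + b * φ) ≤⟨ *-monoʳ-≤ (m + 1) (+-monoˡ-≤ (b * φ) (*-monoʳ-≤ 33 1≤φ)) ⟩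
  (m + 1) * (33 * φ + b * φ) ≡⟨ factor (m + 1) φ b ⟩
  (33 + b) * (φ * (m + 1))   ∎
  where
  open ≤-Reasoning
  factor : ∀ m φ b → m * (33 * φ + b * φ) ≡ (33 + b) * (φ * m)
  factor = solve-∀

module _ (Γ : ConstraintLanguage) (rep : Representation) (f : ℕ → ℕ)
         (solvable : SolvableInTime (SAT rep (Γ ⁺)) (λ φ → f (card (vars φ)))) where

  private
    consistentᴾ = consistent Γ rep f solvable
    cᵇ = proj₁ (consistentBound≼ Γ rep f solvable)
    kᵇ = proj₁ (proj₂ (consistentBound≼ Γ rep f solvable))
    bound≤ = proj₂ (proj₂ (consistentBound≼ Γ rep f solvable))

  check : Program
  check = checkWith consistentᴾ

  -- `5 + 6 * s` bounds the size of a query: `s` for the instance, `1 + 4 * s` for the partial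
  -- assignment, `2 + s` for a list of at most one manifestation, and two nodes joining them.
  queryBound checkBound : ℕ → ℕ
  queryBound s = cᵇ * suc (5 + 6 * s) ^ kᵇ
  checkBound s = 33 + queryBound s

  checkBound≼ : checkBound ∘ size ≼ size
  checkBound≼ = ≼-+ (≼-const 33) (≼-* (≼-const cᵇ)
    (≼-^ (≼-+ (≼-const 6) (≼-* (≼-const 6) ≼-refl)) kᵇ))

  module _ (I : AbductionInstance Γ) where
    open AbductionInstance I

    private
      encI = encodeAbduction rep I
      s = size encI

    H-size : size (encodeVars H) ≤ s
    H-size = ≤-trans (size-hdᵀ (node (encodeVars H) (encodeVars M))) (size-tlᵀ encI)

    M-size : size (encodeVars M) ≤ s
    M-size = ≤-trans (size-tlᵀ (node (encodeVars H) (encodeVars M))) (size-tlᵀ encI)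

    module _ {α : PartialAssignment} (admissible : Admissible H α) where
      open Admissible admissible

      private
        encα = encodePartial α
        φ = f (n ∸ length α)
        W = queryBound s * φ

      query⇓ : ∀ {q} → q ⊆ M → size (encodeVars q) ≤ 2 + s → ∃[ r ] ∃[ t ]
        (consistentᴾ ∶ encodeQuery rep I α q ⇓ encodeBool r [ t ]
        × t ≤ W × (r ≡ true ⇔ Consistent I α q))
      query⇓ {q} q⊆M q-size =
        let r , t , run , t≤ , r⇔ = consistent⇓ Γ rep f solvable I admissible q⊆M
        in r , t , run , ≤-trans t≤ (*-monoˡ-≤ φ
             (≤-trans (bound≤ (encodeQuery rep I α q)) (*-monoʳ-≤ cᵇ (^-monoˡ-≤ kᵇ (s≤s Q≤))))) , r⇔
        where
        open ≤-Reasoning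
        rearrange : ∀ s → 1 + s + (1 + (1 + 4 * s) + (2 + s)) ≡ 5 + 6 * s
        rearrange = solve-∀
        Q≤ : size (encodeQuery rep I α q) ≤ 5 + 6 * s
        Q≤ = begin
          1 + s + (1 + size encα + size (encodeVars q))
            ≤⟨ +-monoʳ-≤ (1 + s) (+-mono-≤
                 (+-monoʳ-≤ 1 (≤-trans small (+-monoʳ-≤ 1 (*-monoʳ-≤ 4 H-size)))) q-size) ⟩
          1 + s + (1 + (1 + 4 * s) + (2 + s)) ≡⟨ rearrange s ⟩
          5 + 6 * s ∎

      query-single⇓ : ∀ {m} → m ∈ M → ∃[ r ] ∃[ t ]
        (consistentᴾ ∶ encodeQuery rep I α (m ∷ []) ⇓ encodeBool r [ t ]
        × t ≤ W × (r ≡ true ⇔ Consistent I α (m ∷ [])))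
      query-single⇓ {m} m∈ = query⇓ {m ∷ []} (λ { (here refl) → m∈ })
        (≤-trans (≤-reflexive (+-comm (1 + size (encodeVar m)) 1))
          (+-monoʳ-≤ 2 (≤-trans (size-∈ encodeVar m∈) M-size)))

      check⇓ : ∃[ r ] ∃[ t ]
        (check ∶ node encI encα ⇓ encodeBool r [ t ]
        × t ≤ checkBound s * (φ * (∣M∣ + 1))
        × (r ≡ true ⇔ Correct I α))
      check⇓ =
        let r , t , run , t≤ , r⇔ = checkWith⇓ {P = λ m → Consistent I α (m ∷ [])} {W}
              query-single⇓ refl (query⇓ {[]} (λ ()) (s≤s z≤n))
            φ-positive = f-positive Γ rep f solvable (n ∸ length α)
        in r , t , run , ≤-trans t≤ (check-cost (queryBound s) φ ∣M∣ φ-positive) , r⇔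

-- Searching for an explanation

data Mode : Set where
  both positive : Mode

-- In positive mode a hypothesis left out stays free instead of being set to false. Hence the length
-- of a candidate is the size of the subset it selects, which yields `f (n ∸ length E)`.
skip : Mode → Var → PartialAssignment → PartialAssignment
skip both     v α = (v , false) ∷ α
skip positive v α = α

take : Var → PartialAssignment → PartialAssignment
take v α = (v , true) ∷ α

candidates : Mode → List Var → PartialAssignment → List PartialAssignment
candidates mode []       α = α ∷ []
candidates mode (v ∷ vs) α =
  candidates mode vs (skip mode v α) ++ candidates mode vs (take v α)

totalWeight : (ℕ → ℕ) → List PartialAssignment → ℕ
totalWeight weight = sum ∘ map (weight ∘ length)

skipᶠ expandᶠ : Mode → PolyFn
skipᶠ both     = ⟨ ⟨ hdᶠ ⨾ᶠ hdᶠ , nilᶠ ⟩ , tlᶠ ⟩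
skipᶠ positive = tlᶠ
expandᶠ mode =
  ⟨ ⟨ ⟨ top ⨾ᶠ hdᶠ ⨾ᶠ tlᶠ , top ⨾ᶠ skipᶠ mode ⟩
    , ⟨ ⟨ top ⨾ᶠ hdᶠ ⨾ᶠ tlᶠ , top ⨾ᶠ ⟨ ⟨ hdᶠ ⨾ᶠ hdᶠ , trueᶠ ⟩ , tlᶠ ⟩ ⟩ , hdᶠ ⨾ᶠ tlᶠ ⟩ ⟩
  , tlᶠ ⟩
  where top = hdᶠ ⨾ᶠ hdᶠ

checkQueryᶠ startᶠ : PolyFn
checkQueryᶠ = ⟨ tlᶠ ⨾ᶠ tlᶠ , hdᶠ ⨾ᶠ hdᶠ ⨾ᶠ tlᶠ ⟩
startᶠ = ⟨ ⟨ ⟨ tlᶠ ⨾ᶠ hdᶠ , nilᶠ ⟩ , nilᶠ ⟩ , ⟨ nilᶠ , idᶠ ⟩ ⟩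

⟦skipᶠ⟧ : ∀ mode v vs α →
  ⟦ skipᶠ mode ⟧ (node (encodeVars (v ∷ vs)) (encodePartial α)) ≡ encodePartial (skip mode v α)
⟦skipᶠ⟧ both     v vs α = refl
⟦skipᶠ⟧ positive v vs α = refl

time-expandᶠ : ∀ mode x → time (expandᶠ mode) x ≤ 47
time-expandᶠ both     x = ≤-refl
time-expandᶠ positive x = m≤m+n 41 6

Any-++⇔ : {A : Set} {P : A → Set} (xs : List A) {ys : List A} →
          (Any P xs ⊎ Any P ys) ⇔ Any P (xs ++ ys)
Any-++⇔ xs = mk⇔ [ Any.++⁺ˡ , Any.++⁺ʳ xs ]′ (Any.++⁻ xs)

module _ (check : Program) where

  visit : Program
  visit = cons (hd ⨾ tl)
    (cons (if prog checkQueryᶠ ⨾ check then prog trueᶠ else (tl ⨾ hd)) (tl ⨾ tl))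

  -- The state is node stack (node found I); the stack lists pairs of the
  -- hypotheses still to be decided and the partial assignment built so far.
  search : Mode → Program
  search mode = while hd loop (if hd ⨾ hd ⨾ hd then prog (expandᶠ mode) else visit)

  abduceWith : Mode → Program
  abduceWith mode = prog startᶠ ⨾ search mode ⨾ tl ⨾ hd

-- In `sizes`, undecided hypotheses reserve four times their size for future bindings. At the end
-- the empty list still reserves 4 of the 5 units; cancelling them gives the bound `small` of
-- `Admissible`.
record Pending (H vs : List Var) (α : PartialAssignment) : Set where
  field
    unique-vs : Unique vs
    unique-α  : Unique (dom α)
    disjoint  : ∀ {v} → v ∈ vs → v ∉ dom α
    vs⊆H      : vs ⊆ H
    α⊆H       : dom α ⊆ H
    sizes     : size (encodePartial α) + 4 * size (encodeVars vs)
                ≤ 5 + 4 * size (encodeVars H)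

module _ {H : List Var} where

  pending-start : Unique H → Pending H H []
  pending-start H-unique = record
    { unique-vs = H-unique ; unique-α = [] ; disjoint = λ _ () ; vs⊆H = λ v∈ → v∈
    ; α⊆H = λ () ; sizes = +-monoˡ-≤ (4 * size (encodeVars H)) {1} {5} (s≤s z≤n) }

  pending-bind : ∀ {v vs α} b → Pending H (v ∷ vs) α → Pending H vs ((v , b) ∷ α)
  pending-bind {v} {vs} {α} b p with v∉ ∷ u ← Pending.unique-vs p = record
    { unique-vs = u
    ; unique-α  = All.tabulate (λ w∈ v≡w → disjoint (here refl) (subst (_∈ dom α) (sym v≡w) w∈))
                  ∷ unique-α
    ; disjoint  = λ { w∈ (here refl)  → All.lookup v∉ w∈ refl
                    ; w∈ (there w∈α) → disjoint (there w∈) w∈α }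
    ; vs⊆H      = vs⊆H ∘ there
    ; α⊆H       = λ { (here refl) → vs⊆H (here refl) ; (there w∈) → α⊆H w∈ }
    ; sizes     = ≤-trans binding-size sizes }
    where
    open Pending p
    open ≤-Reasoning
    bool-size : ∀ b → size (encodeBool b) ≤ 3
    bool-size false = s≤s z≤n
    bool-size true  = ≤-refl
    sv = size (encodeVar v)
    svs = size (encodeVars vs)
    sα = size (encodePartial α)
    binding-size : size (encodePartial ((v , b) ∷ α)) + 4 * svs
                   ≤ sα + 4 * size (encodeVars (v ∷ vs))
    binding-size = begin
      1 + (1 + sv + size (encodeBool b)) + sα + 4 * svs
        ≤⟨ +-monoˡ-≤ (4 * svs) (+-monoˡ-≤ sα (+-monoʳ-≤ (2 + sv) (bool-size b))) ⟩
      1 + (1 + sv + 3) + sα + 4 * svs       ≡⟨ expand sv sα svs ⟩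
      -- A binding adds at most `5 + sv` and releases `4 + 4 * sv`, which suffices because a
      -- variable has size at least one.
      sα + (4 + 4 * svs + sv + 1)           ≤⟨ +-monoʳ-≤ sα (+-monoʳ-≤ (4 + 4 * svs + sv) 1≤3sv) ⟩
      sα + (4 + 4 * svs + sv + 3 * sv)      ≡⟨ contract sv sα svs ⟩
      sα + 4 * (1 + sv + svs)               ∎
      where
      expand : ∀ v a w → 1 + (1 + v + 3) + a + 4 * w ≡ a + (4 + 4 * w + v + 1)
      expand = solve-∀
      contract : ∀ v a w → a + (4 + 4 * w + v + 3 * v) ≡ a + 4 * (1 + v + w)
      contract = solve-∀
      1≤3sv : 1 ≤ 3 * sv
      1≤3sv = ≤-trans (size-positive (encodeVar v)) (m≤m+n sv _)

  pending-skip : ∀ mode {v vs α} → Pending H (v ∷ vs) α → Pending H vs (skip mode v α)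
  pending-skip both     p = pending-bind false p
  pending-skip positive {v} {vs} p with _ ∷ u ← Pending.unique-vs p = record
    { unique-vs = u
    ; unique-α  = unique-α
    ; disjoint  = disjoint ∘ there
    ; vs⊆H      = vs⊆H ∘ there
    ; α⊆H       = α⊆H
    ; sizes     = ≤-trans (+-monoʳ-≤ _ (*-monoʳ-≤ 4 (size-tlᵀ (encodeVars (v ∷ vs))))) sizes }
    where open Pending p

  pending-done : ∀ {α} → Pending H [] α → Admissible H α
  pending-done {α} p = record
    { unique = unique-α ; hypotheses = α⊆H
    ; small = +-cancelʳ-≤ 4 _ _ (≤-trans sizes (≤-reflexive (+-comm 4 (1 + 4 * size (encodeVars H))))) }
    where open Pending p

module _ {check : Program} {encI : Tree} {H : List Var} {Correct : PartialAssignment → Set}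
         {weight : ℕ → ℕ} {B : ℕ} (weight-positive : ∀ l → 1 ≤ weight l)
         (check⇓ : ∀ {α} → Admissible H α → ∃[ r ] ∃[ t ]
           (check ∶ node encI (encodePartial α) ⇓ encodeBool r [ t ]
           × t ≤ B * weight (length α) × (r ≡ true ⇔ Correct α))) where

  -- Stated for an arbitrary continuation, so that the runs for the two subtrees
  -- of the search compose.

  Processed : Mode → List Var → PartialAssignment → Bool → ℕ → Set
  Processed mode vs α r u = ∀ {stack found y w} →
    search check mode ∶ node stack (node (encodeBool (found ∨ r)) encI) ⇓ y [ w ] →
    search check mode ∶ node (node (node (encodeVars vs) (encodePartial α)) stack)
                       (node (encodeBool found) encI) ⇓ y [ u + w ]

  -- A visit costs 30 steps besides the check, an expansion at most 55.  Each
  -- visit also pays for one expansion (whence 85), since a binary tree has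
  -- fewer inner nodes than leaves.

  search⇓ : ∀ mode vs {α} → Pending H vs α → ∃[ r ] ∃[ u ]
    (Processed mode vs α r u
    × u + 55 ≤ (85 + B) * totalWeight weight (candidates mode vs α)
    × (r ≡ true ⇔ Any Correct (candidates mode vs α)))
  search⇓ mode [] {α} p with check⇓ (pending-done p)
  ... | r , t , run , t≤ , r⇔ = r , 30 + t , processed , bound ,
    mk⇔ (λ r≡ → here (to r⇔ r≡)) (λ { (here correct) → from r⇔ correct ; (there ()) })
    where
    open ≤-Reasoning
    cost : ∀ t w → 2 + (1 + 5 + (1 + 3 + (1 + (1 + (1 + 9 + t) + 3) + 3))) + w ≡ 30 + t + w
    cost = solve-∀
    update : ∀ r found → ifᵀ (encodeBool r) (node leaf leaf) (encodeBool found)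
                         ≡ encodeBool (found ∨ r)
    update false false = refl
    update false true  = refl
    update true  false = refl
    update true  true  = refl
    ifᵀ-same : ∀ c (l : ℕ) → ifᵀ c l l ≡ l
    ifᵀ-same leaf       l = refl
    ifᵀ-same (node _ _) l = refl
    processed : Processed mode [] α r (30 + t)
    processed {stack} {found} {y} {w} next =
      subst (λ l → search check mode ∶ state ⇓ y [ l ])
        (trans (cong (λ i → 2 + (1 + 5 + (1 + 3 + (1 + (1 + (1 + 9 + t) + i) + 3))) + w)
                     (ifᵀ-same (encodeBool r) 3))
               (cost t w))
        (while-step⇓ hd-node⇓
          (if-false⇓ (⨾⇓ hd-node⇓ (⨾⇓ hd-node⇓ hd-node⇓))
            (cons⇓ (⨾⇓ hd-node⇓ tl-node⇓)
              (cons⇓ (if⇓ (encodeBool r) (⨾⇓ (runs checkQueryᶠ state) run)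
                          (runs trueᶠ state) (⨾⇓ tl-node⇓ hd-node⇓))
                     (⨾⇓ tl-node⇓ tl-node⇓))))
          (subst (λ b → search check mode ∶ node stack (node b encI) ⇓ y [ w ])
                 (sym (update r found)) next))
      where
      state = node (node (node leaf (encodePartial α)) stack) (node (encodeBool found) encI)
    factor : ∀ c g → 85 * g + c * g ≡ (85 + c) * (g + 0)
    factor = solve-∀
    rearrange : ∀ t → 30 + t + 55 ≡ 85 * 1 + t
    rearrange = solve-∀
    bound : 30 + t + 55 ≤ (85 + B) * totalWeight weight (α ∷ [])
    bound = begin
      30 + t + 55  ≡⟨ rearrange t ⟩
      85 * 1 + t   ≤⟨ +-mono-≤ (*-monoʳ-≤ 85 (weight-positive (length α))) t≤ ⟩
      85 * weight (length α) + B * weight (length α)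
        ≡⟨ factor (B) (weight (length α)) ⟩
      (85 + B) * totalWeight weight (α ∷ []) ∎
  search⇓ mode (v ∷ vs) {α} p
    with search⇓ mode vs (pending-skip mode p) | search⇓ mode vs (pending-bind true p)
  ... | r₁ , u₁ , processed₁ , u₁≤ , r₁⇔ | r₂ , u₂ , processed₂ , u₂≤ , r₂⇔ =
    r₁ ∨ r₂ , 8 + time (expandᶠ mode) leaf + (u₁ + u₂) , processed , bound ,
    mk⇔ (to (Any-++⇔ cs₁) ∘ [ inj₁ ∘ to r₁⇔ , inj₂ ∘ to r₂⇔ ]′ ∘ ∨-true⁻)
        (∨-true⁺ ∘ [ inj₁ ∘ from r₁⇔ , inj₂ ∘ from r₂⇔ ]′ ∘ from (Any-++⇔ cs₁))
    where
    open ≤-Reasoning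
    cs₁ = candidates mode vs (skip mode v α)
    cs₂ = candidates mode vs (take v α)
    C = (85 + B)
    e = time (expandᶠ mode) leaf
    time-constant : ∀ mode x → time (expandᶠ mode) x ≡ time (expandᶠ mode) leaf
    time-constant both     x = refl
    time-constant positive x = refl
    cost : ∀ e u₁ u₂ w → 2 + (1 + 5 + e) + (u₁ + (u₂ + w)) ≡ 8 + e + (u₁ + u₂) + w
    cost = solve-∀
    processed : Processed mode (v ∷ vs) α (r₁ ∨ r₂) (8 + e + (u₁ + u₂))
    processed {stack} {found} {y} {w} next =
      subst (λ l → search check mode ∶ state ⇓ y [ l ])
        (trans (cong (λ e → 2 + (1 + 5 + e) + (u₁ + (u₂ + w))) (time-constant mode state))
               (cost e u₁ u₂ w))
        (while-step⇓ hd-node⇓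
          (if-true⇓ (⨾⇓ hd-node⇓ (⨾⇓ hd-node⇓ hd-node⇓)) (runs (expandᶠ mode) state))
          (subst (λ x → search check mode ∶ node (node (node (encodeVars vs) x)
                     (node (node (encodeVars vs) (encodePartial (take v α))) stack))
                     (node (encodeBool found) encI) ⇓ y [ u₁ + (u₂ + w) ])
            (sym (⟦skipᶠ⟧ mode v vs α))
            (processed₁ (processed₂
              (subst (λ b → search check mode ∶ node stack (node (encodeBool b) encI) ⇓ y [ w ])
                     (sym (Bool.∨-assoc found r₁ r₂)) next)))))
      where
      state = node (node (node (encodeVars (v ∷ vs)) (encodePartial α)) stack)
                   (node (encodeBool found) encI)
    rearrange : ∀ u₁ u₂ → 8 + 47 + (u₁ + u₂) + 55 ≡ u₁ + 55 + (u₂ + 55)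
    rearrange = solve-∀
    bound : 8 + e + (u₁ + u₂) + 55 ≤ C * totalWeight weight (cs₁ ++ cs₂)
    bound = begin
      8 + e + (u₁ + u₂) + 55
        ≤⟨ +-monoˡ-≤ 55 (+-monoˡ-≤ (u₁ + u₂) (+-monoʳ-≤ 8 (time-expandᶠ mode leaf))) ⟩
      8 + 47 + (u₁ + u₂) + 55                      ≡⟨ rearrange u₁ u₂ ⟩
      u₁ + 55 + (u₂ + 55)                          ≤⟨ +-mono-≤ u₁≤ u₂≤ ⟩
      C * totalWeight weight cs₁ + C * totalWeight weight cs₂
        ≡⟨ *-distribˡ-+ C (totalWeight weight cs₁) (totalWeight weight cs₂) ⟨
      C * (totalWeight weight cs₁ + totalWeight weight cs₂)
        ≡⟨ cong (C *_) (trans (cong sum (List.map-++ (weight ∘ length) cs₁ cs₂))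
                              (sum-++ (map (weight ∘ length) cs₁) _)) ⟨
      C * totalWeight weight (cs₁ ++ cs₂)                 ∎

  abduceWith⇓ : ∀ {encKB encM} → encI ≡ node encKB (node (encodeVars H) encM) → Unique H →
    ∀ mode → ∃[ r ] ∃[ t ]
    (abduceWith check mode ∶ encI ⇓ encodeBool r [ t ]
    × t ≤ (85 + B) * totalWeight weight (candidates mode H [])
    × (r ≡ true ⇔ Any Correct (candidates mode H [])))
  abduceWith⇓ refl H-unique mode with search⇓ mode H (pending-start H-unique)
  ... | r , u , processed , u≤ , r⇔ = r , _ ,
    ⨾⇓ (runs startᶠ encI)
       (⨾⇓ (processed {found = false} (while-stop⇓ hd-node⇓)) (⨾⇓ tl-node⇓ hd-node⇓)) ,
    -- The 55 steps left in reserve by the search cover the 18 steps of starting and finishing.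
    ≤-trans (≤-trans (≤-reflexive (cost u)) (+-monoʳ-≤ u (m≤m+n 18 37))) u≤ ,
    r⇔
    where
    cost : ∀ u → 1 + (1 + (1 + (1 + 3 + 1) + 1) + (1 + 1 + 1)) + (1 + (u + 2) + 3) ≡ u + 18
    cost = solve-∀

-- Total weight of the candidates

weights-both : ∀ weight vs α →
  totalWeight weight (candidates both vs α) ≡ 2 ^ length vs * weight (length vs + length α)
weights-both weight []       α = refl
weights-both weight (v ∷ vs) α = begin
  sum (map g (cs false ++ cs true))            ≡⟨ cong sum (List.map-++ g (cs false) (cs true)) ⟩
  sum (map g (cs false) ++ map g (cs true))    ≡⟨ sum-++ (map g (cs false)) (map g (cs true)) ⟩
  sum (map g (cs false)) + sum (map g (cs true))
    ≡⟨ cong₂ _+_ (weights-both weight vs ((v , false) ∷ α))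
                 (weights-both weight vs ((v , true) ∷ α)) ⟩
  p * weight (length vs + suc (length α)) + p * weight (length vs + suc (length α))
    ≡⟨ cong (λ l → p * weight l + p * weight l) (+-suc (length vs) (length α)) ⟩
  p * w + p * w                                ≡⟨ double p w ⟩
  2 * p * w                                    ∎
  where
  open ≡-Reasoning
  g = weight ∘ length
  cs : Bool → List PartialAssignment
  cs b = candidates both vs ((v , b) ∷ α)
  p = 2 ^ length vs
  w = weight (suc (length vs + length α))
  double : ∀ p w → p * w + p * w ≡ 2 * p * w
  double = solve-∀

-- Positive candidates and `subsets` branch in the same order: without the first variable, then with
-- it. Bindings are accumulated in `α`, subsets are built on the way back, so only the lengths are
-- matched.
weights-positive : ∀ weight vs α →
  totalWeight weight (candidates positive vs α)
  ≡ sum (map (λ E → weight (length E + length α)) (subsets vs))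
weights-positive weight []       α = refl
weights-positive weight (v ∷ vs) α = begin
  sum (map g (cs₀ ++ cs₁))                 ≡⟨ cong sum (List.map-++ g cs₀ cs₁) ⟩
  sum (map g cs₀ ++ map g cs₁)             ≡⟨ sum-++ (map g cs₀) (map g cs₁) ⟩
  sum (map g cs₀) + sum (map g cs₁)
    ≡⟨ cong₂ _+_ (weights-positive weight vs α) (weights-positive weight vs (take v α)) ⟩
  sum (map h (subsets vs)) + sum (map (λ E → weight (length E + suc (length α))) (subsets vs))
    ≡⟨ cong (λ l → sum (map h (subsets vs)) + sum l)
         (trans (List.map-cong (λ E → cong weight (+-suc (length E) (length α))) (subsets vs))
                (List.map-∘ (subsets vs))) ⟩
  sum (map h (subsets vs)) + sum (map h (map (v ∷_) (subsets vs)))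
    ≡⟨ sum-++ (map h (subsets vs)) _ ⟨
  sum (map h (subsets vs) ++ map h (map (v ∷_) (subsets vs)))
    ≡⟨ cong sum (List.map-++ h (subsets vs) _) ⟨
  sum (map h (subsets (v ∷ vs)))           ∎
  where
  open ≡-Reasoning
  g = weight ∘ length
  h : List Var → ℕ
  h E = weight (length E + length α)
  cs₀ = candidates positive vs α
  cs₁ = candidates positive vs (take v α)

-- Candidates versus explanations

literal : Var × Bool → Literal
literal (v , true)  = pos v
literal (v , false) = neg v

variable-of : Literal → Var
variable-of (pos v) = v
variable-of (neg v) = v

agrees⇒literals : ∀ {σ} α → Agrees σ α → All (σ ⊨ˡ_) (map literal α)
agrees⇒literals []                []         = []
agrees⇒literals ((v , true) ∷ α)  (σv ∷ agr) = σv ∷ agrees⇒literals α agr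
agrees⇒literals ((v , false) ∷ α) (σv ∷ agr) = σv ∷ agrees⇒literals α agr

literals⇒agrees : ∀ {σ} α → All (σ ⊨ˡ_) (map literal α) → Agrees σ α
literals⇒agrees []                []         = []
literals⇒agrees ((v , true) ∷ α)  (σv ∷ lit) = σv ∷ literals⇒agrees α lit
literals⇒agrees ((v , false) ∷ α) (σv ∷ lit) = σv ∷ literals⇒agrees α lit

-- The guard `mode ≡ both` makes the condition on negative bindings vacuous in positive mode, so one
-- statement covers both searches.
candidates-All : ∀ mode {Q : Var × Bool → Set} vs {α} →
  (∀ {v} → v ∈ vs → Q (v , true)) → (mode ≡ both → ∀ {v} → v ∈ vs → Q (v , false)) →
  All Q α → All (All Q) (candidates mode vs α)
candidates-All mode []       qt qf qα = qα ∷ []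
candidates-All both (v ∷ vs) qt qf qα = All.++⁺
  (candidates-All both vs (qt ∘ there) (λ eq v∈ → qf eq (there v∈)) (qf refl (here refl) ∷ qα))
  (candidates-All both vs (qt ∘ there) (λ eq v∈ → qf eq (there v∈)) (qt (here refl) ∷ qα))
candidates-All positive (v ∷ vs) qt qf qα = All.++⁺
  (candidates-All positive vs (qt ∘ there) (λ ()) qα)
  (candidates-All positive vs (qt ∘ there) (λ ()) (qt (here refl) ∷ qα))

-- The candidate found is the restriction of `σ` to `vs`, added to `α`.
candidates-both : ∀ (σ : Assignment) vs {α} → Agrees σ α →
  Any (λ β → Agrees σ β × (∀ {v} → v ∈ vs ⊎ v ∈ dom α → v ∈ dom β)) (candidates both vs α)
candidates-both σ []       agr = here (agr , [ (λ ()) , (λ v∈ → v∈) ]′)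
candidates-both σ (w ∷ vs) {α} agr = go (σ w) refl
  where
  extend : ∀ {β} → Agrees σ β × (∀ {v} → v ∈ vs ⊎ v ∈ w ∷ dom α → v ∈ dom β) →
           Agrees σ β × (∀ {v} → v ∈ w ∷ vs ⊎ v ∈ dom α → v ∈ dom β)
  extend (agr , cover) = agr , λ
    { (inj₁ (here v≡w)) → cover (inj₂ (here v≡w))
    ; (inj₁ (there v∈)) → cover (inj₁ v∈)
    ; (inj₂ v∈)         → cover (inj₂ (there v∈)) }
  go : ∀ b → σ w ≡ b →
    Any (λ β → Agrees σ β × (∀ {v} → v ∈ w ∷ vs ⊎ v ∈ dom α → v ∈ dom β))
        (candidates both (w ∷ vs) α)
  go false σw = Any.++⁺ˡ (Any.map extend (candidates-both σ vs (σw ∷ agr)))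
  go true  σw = Any.++⁺ʳ (candidates both vs ((w , false) ∷ α))
                  (Any.map extend (candidates-both σ vs (σw ∷ agr)))

-- `S` may list variables in any order and with repetitions; the candidate found selects the members
-- of `vs` that lie in `S`.
candidates-positive : ∀ (S vs : List Var) {α} → All (λ (v , b) → v ∈ S × b ≡ true) α →
  Any (λ β → All (λ (v , b) → v ∈ S × b ≡ true) β
           × (∀ {v} → (v ∈ vs × v ∈ S) ⊎ v ∈ dom α → v ∈ dom β))
      (candidates positive vs α)
candidates-positive S []       sel = here (sel , [ (λ ()) , (λ v∈ → v∈) ]′)
candidates-positive S (w ∷ vs) {α} sel with w ∈? S
... | yes w∈S = Any.++⁺ʳ (candidates positive vs α) (Any.map
        (λ (sel , cover) → sel , λ
          { (inj₁ (here v≡w , _))   → cover (inj₂ (here v≡w))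
          ; (inj₁ (there v∈ , v∈S)) → cover (inj₁ (v∈ , v∈S))
          ; (inj₂ v∈)               → cover (inj₂ (there v∈)) })
        (candidates-positive S vs ((w∈S , refl) ∷ sel)))
... | no  w∉S = Any.++⁺ˡ (Any.map
        (λ (sel , cover) → sel , λ
          { (inj₁ (here refl , w∈S)) → ⊥-elim (w∉S w∈S)
          ; (inj₁ (there v∈ , v∈S))  → cover (inj₁ (v∈ , v∈S))
          ; (inj₂ v∈)                → cover (inj₂ v∈) })
        (candidates-positive S vs sel))

⊆-literals : ∀ {α ls} → All (λ b → literal b ∈ᵖ ls) α → map literal α ⊆ ls
⊆-literals α⊆ l∈ with ∈-map⁻ literal l∈
... | _ , b∈ , refl = All.lookup α⊆ b∈

module _ {Γ : ConstraintLanguage} (I : AbductionInstance Γ) where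
  open AbductionInstance I

  Correct⇒Explains : ∀ {α} → Correct I α → Explains I (map literal α)
  Correct⇒Explains {α} ((σ , σ⊨KB , agr , _) , none) =
    (σ , σ⊨KB , agrees⇒literals α agr) , λ {m} m∈ τ τ⊨KB lits →
      Bool.¬-not λ τm≡false → All.lookup none m∈
        (τ , τ⊨KB , literals⇒agrees α lits , τm≡false ∷ [])

  -- Replacing `E` by a stronger assignment preserves entailment and can only endanger consistency,
  -- which `σ` secures.
  Explains⇒Correct : ∀ {E α σ} → Explains I E → σ ⊨ KB → Agrees σ α →
    (∀ τ → Agrees τ α → All (τ ⊨ˡ_) E) → Correct I α
  Explains⇒Correct {σ = σ} (_ , entails) σ⊨KB agr α⇒E =
    (σ , σ⊨KB , agr , []) ,
    All.tabulate λ { m∈ (τ , τ⊨KB , τ-α , τm≡false ∷ []) →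
      Bool.not-¬ τm≡false (entails m∈ τ τ⊨KB (α⇒E τ τ-α)) }

  -- An explanation may be completed on H by the values of one of its models.

  explanation⇔ : Any (Correct I) (candidates both H []) ⇔ HasExplanation I
  explanation⇔ = mk⇔ sound complete
    where
    literals-⊆ : All (All (λ b → literal b ∈ᵖ map pos H ++ map neg H)) (candidates both H [])
    literals-⊆ = candidates-All both H (λ v∈ → ∈-++⁺ˡ (∈-map⁺ pos v∈))
      (λ _ v∈ → ∈-++⁺ʳ (map pos H) (∈-map⁺ neg v∈)) []
    sound : Any (Correct I) (candidates both H []) → HasExplanation I
    sound any with find any
    ... | α , α∈ , correct = map literal α , ⊆-literals (All.lookup literals-⊆ α∈) ,
                             Correct⇒Explains correct
    complete : HasExplanation I → Any (Correct I) (candidates both H [])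
    complete (E , E⊆ , explains@((σ , σ⊨KB , σ⊨E) , _)) =
      Any.map (λ (agr , cover) → Explains⇒Correct explains σ⊨KB agr λ τ τ-β →
                All.tabulate λ {l} l∈ → transfer τ τ-β agr cover l (E⊆ l∈) (All.lookup σ⊨E l∈))
        (candidates-both σ H [])
      where
      same : ∀ τ {β} → Agrees τ β → Agrees σ β → ∀ {v} → v ∈ dom β → τ v ≡ σ v
      same τ τ-β σ-β v∈ with ∈-map⁻ proj₁ v∈
      ... | _ , b∈ , refl = trans (All.lookup τ-β b∈) (sym (All.lookup σ-β b∈))
      transfer : ∀ τ {β} → Agrees τ β → Agrees σ β →
        (∀ {v} → v ∈ H ⊎ v ∈ [] → v ∈ dom β) →
        ∀ l → l ∈ᵖ map pos H ++ map neg H → σ ⊨ˡ l → τ ⊨ˡ l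
      transfer τ τ-β σ-β cover l l∈ σ⊨l with ∈-++⁻ (map pos H) l∈
      ... | inj₁ l∈⁺ with ∈-map⁻ pos l∈⁺
      ...   | v , v∈ , refl = trans (same τ τ-β σ-β (cover (inj₁ v∈))) σ⊨l
      transfer τ τ-β σ-β cover l l∈ σ⊨l | inj₂ l∈⁻ with ∈-map⁻ neg l∈⁻
      ...   | v , v∈ , refl = trans (same τ τ-β σ-β (cover (inj₁ v∈))) σ⊨l

  -- A model cannot be used to complete a positive explanation, as its false hypotheses may not be
  -- asserted. The candidate therefore binds exactly the variables of `E`; any model of `E` makes
  -- them true, so the one supplied with the explanation witnesses consistency.
  positiveExplanation⇔ : Any (Correct I) (candidates positive H []) ⇔ HasPositiveExplanation I
  positiveExplanation⇔ = mk⇔ sound complete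
    where
    literals-⊆ : All (All (λ b → literal b ∈ᵖ map pos H)) (candidates positive H [])
    literals-⊆ = candidates-All positive H (∈-map⁺ pos) (λ ()) []
    sound : Any (Correct I) (candidates positive H []) → HasPositiveExplanation I
    sound any with find any
    ... | α , α∈ , correct = map literal α , ⊆-literals (All.lookup literals-⊆ α∈) ,
                             Correct⇒Explains correct
    complete : HasPositiveExplanation I → Any (Correct I) (candidates positive H [])
    complete (E , E⊆ , explains@((σ , σ⊨KB , σ⊨E) , _)) =
      Any.map (λ {β} (sel , cover) → Explains⇒Correct explains σ⊨KB (agrees sel) λ τ τ-β →
                All.tabulate λ {l} l∈ → satisfied τ τ-β sel cover l∈ (E⊆ l∈))
        (candidates-positive S H [])
      where
      S = map variable-of E
      Selected : PartialAssignment → Set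
      Selected = All (λ (v , b) → v ∈ S × b ≡ true)
      true-in-σ : ∀ {v} → v ∈ S → σ v ≡ true
      true-in-σ v∈ with ∈-map⁻ variable-of v∈
      ... | l , l∈ , refl with ∈-map⁻ pos (E⊆ l∈)
      ...   | _ , _ , refl = All.lookup σ⊨E l∈
      agrees : ∀ {β} → Selected β → Agrees σ β
      agrees = All.map λ { (v∈S , refl) → true-in-σ v∈S }
      satisfied : ∀ τ {β} → Agrees τ β → Selected β →
        (∀ {v} → (v ∈ H × v ∈ S) ⊎ v ∈ [] → v ∈ dom β) →
        ∀ {l} → l ∈ᵖ E → l ∈ᵖ map pos H → τ ⊨ˡ l
      satisfied τ τ-β sel cover l∈E l∈ with ∈-map⁻ pos l∈
      ... | v , v∈ , refl with ∈-map⁻ proj₁ (cover (inj₁ (v∈ , ∈-map⁺ variable-of l∈E)))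
      ...   | _ , b∈ , refl = trans (All.lookup τ-β b∈) (proj₂ (All.lookup sel b∈))

-- Overhead in the required form, and conclusion

*-^-distrib : ∀ m n k → (m * n) ^ k ≡ m ^ k * n ^ k
*-^-distrib m n zero    = refl
*-^-distrib m n (suc k) = trans (cong (m * n *_) (*-^-distrib m n k)) (p m n (m ^ k) (n ^ k))
  where
  p : ∀ a b c d → a * b * (c * d) ≡ a * c * (b * d)
  p = solve-∀

-- The successor in the base is traded for the factor `2 ^ k`, as a tree has size at least one.
≼⇒overhead : {A : Set} {T : A → ℕ} {t : A → Tree} → T ≼ size ∘ t →
             ∃[ c ] ∃[ k ] (∀ a → T a ≤ c * size (t a) ^ k)
≼⇒overhead {T = T} {t} (c , k , T≤) = c * 2 ^ k , k , λ a → begin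
  T a                                ≤⟨ T≤ a ⟩
  c * suc (size (t a)) ^ k           ≤⟨ *-monoʳ-≤ c (^-monoˡ-≤ k (double (size-positive (t a)))) ⟩
  c * (2 * size (t a)) ^ k           ≡⟨ cong (c *_) (*-^-distrib 2 (size (t a)) k) ⟩
  c * (2 ^ k * size (t a) ^ k)       ≡⟨ *-assoc c (2 ^ k) _ ⟨
  c * 2 ^ k * size (t a) ^ k         ∎
  where
  open ≤-Reasoning
  double : ∀ {s} → 1 ≤ s → suc s ≤ 2 * s
  double {s} 1≤s = ≤-trans (+-monoˡ-≤ s 1≤s) (+-monoʳ-≤ s (m≤m+n s 0))

module _ (Γ : ConstraintLanguage) (rep : Representation) (f : ℕ → ℕ)
         (solvable : SolvableInTime (SAT rep (Γ ⁺)) (λ φ → f (card (vars φ)))) where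

  private
    B : ℕ → ℕ
    B = checkBound Γ rep f solvable

  candidateWeight : AbductionInstance Γ → ℕ → ℕ
  candidateWeight I l = f (n ∸ l) * (∣M∣ + 1)
    where open AbductionInstance I

  abduce⇓ : ∀ mode (I : AbductionInstance Γ) → let open AbductionInstance I in ∃[ r ] ∃[ t ]
    (abduceWith (check Γ rep f solvable) mode ∶ encodeAbduction rep I ⇓ encodeBool r [ t ]
    × t ≤ (85 + B (size (encodeAbduction rep I))) *
          totalWeight (candidateWeight I) (candidates mode H [])
    × (r ≡ true ⇔ Any (Correct I) (candidates mode H [])))
  abduce⇓ mode I = abduceWith⇓ {weight = candidateWeight I} {B = B (size (encodeAbduction rep I))}
    (λ l → *-mono-≤ (f-positive Γ rep f solvable (n ∸ l)) (m≤n+m 1 ∣M∣))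
    (check⇓ Γ rep f solvable I) refl H-unique mode
    where open AbductionInstance I

  abduction-solvable :
    ∀ mode (Yes : AbductionInstance Γ → Set) (T : AbductionInstance Γ → ℕ) →
    (∀ I → Any (Correct I) (candidates mode (AbductionInstance.H I) []) ⇔ Yes I) →
    (∀ I → totalWeight (candidateWeight I) (candidates mode (AbductionInstance.H I) []) ≡ T I) →
    SolvableInTime (record { Instance = AbductionInstance Γ
                           ; encode = encodeAbduction rep ; Yes = Yes }) T
  abduction-solvable mode Yes T correct⇔ weights =
    let c , k , bound≤ = ≼⇒overhead {t = encodeAbduction rep}
          (≼-∘ (≼-+ (≼-const 85) (checkBound≼ Γ rep f solvable)) (encodeAbduction rep))
    in abduceWith (check Γ rep f solvable) mode , c , k , λ I →
       let r , t , run , t≤ , r⇔ = abduce⇓ mode I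
       in r , t , run ,
          ≤-trans (subst (λ w → t ≤ (85 + B (size (encodeAbduction rep I))) * w) (weights I) t≤)
                  (*-monoˡ-≤ (T I) (bound≤ I)) ,
          mk⇔ (to (correct⇔ I) ∘ to r⇔) (from r⇔ ∘ from (correct⇔ I))

theorem3 : (Γ : ConstraintLanguage) (rep : Representation) (f : ℕ → ℕ) →
    Computable f →
    SolvableInTime (SAT rep (Γ ⁺)) (λ φ → f (card (vars φ))) →
    SolvableInTime (ABD rep Γ) (λ I → let open AbductionInstance I in
    2 ^ ∣H∣ * f (n ∸ ∣H∣) * (∣M∣ + 1))
    × SolvableInTime (P-ABD rep Γ) (λ I → let open AbductionInstance I in
    sum (map (λ E → f (n ∸ length E) * (∣M∣ + 1)) (subsets H)))
theorem3 Γ rep f _ solvable =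
  abduction-solvable Γ rep f solvable both HasExplanation _ explanation⇔ (λ I →
    let open AbductionInstance I in
    trans (weights-both (weight I) H [])
      (trans (cong (λ l → 2 ^ ∣H∣ * weight I l) (+-identityʳ ∣H∣))
             (sym (*-assoc (2 ^ ∣H∣) (f (n ∸ ∣H∣)) (∣M∣ + 1))))) ,
  abduction-solvable Γ rep f solvable positive HasPositiveExplanation _ positiveExplanation⇔ (λ I →
    let open AbductionInstance I in
    trans (weights-positive (weight I) H [])
      (cong sum (List.map-cong (λ E → cong (weight I) (+-identityʳ (length E))) (subsets H))))
  where
  weight = candidateWeight Γ rep f solvable
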